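{- Let $P(x) \in \mathbb{Q}[x]$ be an integer-valued polynomial (i.e. $P(\mathbb{Z}) \subseteq \mathbb{Z}$) with $\deg P \ge 2$. Then for every $\varepsilon > 0$ there exists a set $A \subseteq \mathbb{N}$ with $d^*(A) > 1 - \varepsilon$ such that whenever $B \subseteq \mathbb{N}$ and $t \in \mathbb{Z}$ satisfy $$\{P(b_1) + b_2 + t : b_1, b_2 \in B,\ b_1 < b_2\} \subseteq A,$$ the set $B$ is finite.
   Context: $\mathbb{N} = \{1,2,3,\dots\}$. $d^*$ denotes the (additive) upper Banach density of a subset of $\mathbb{N}$: $d^*(A) = \lim_{N\to\infty} \sup_{M \ge 0} |A \cap \{M+1, \dots, M+N\}|/N$. -}

module Defs where

open import Data.Nat as ℕ using (ℕ; zero; suc)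
open import Data.Integer as ℤ using (ℤ; +_)
open import Data.Rational as ℚ using (ℚ; 0ℚ; 1ℚ; _/_)
open import Data.List using (List; []; _∷_)
open import Data.Bool using (Bool; true; false)
open import Data.Product using (Σ; ∃; _×_; _,_)
open import Relation.Binary.PropositionalEquality using (_≡_; _≢_)

-- A polynomial in ℚ[x], given by its list of coefficients:
-- (c₀ ∷ c₁ ∷ … ∷ cₖ) represents c₀ + c₁ x + … + cₖ xᵏ.
Poly : Set
Poly = List ℚ

coeff : Poly → ℕ → ℚ
coeff []       _       = 0ℚ
coeff (c ∷ cs) zero    = c
coeff (c ∷ cs) (suc i) = coeff cs i

eval : Poly → ℚ → ℚ
eval []       x = 0ℚ
eval (c ∷ cs) x = c ℚ.+ x ℚ.* eval cs x

toℚ : ℤ → ℚ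
toℚ z = z / 1

IntegerValued : Poly → Set
IntegerValued P = ∀ (z : ℤ) → ∃ λ (k : ℤ) → eval P (toℚ z) ≡ toℚ k

DegreeAtLeast2 : Poly → Set
DegreeAtLeast2 P = ∃ λ (i : ℕ) → (2 ℕ.≤ i) × (coeff P i ≢ 0ℚ)

-- Subsets of ℕ = {1,2,3,…} used for the density set A are given by a
-- decidable indicator A : ℕ → Bool (the value at 0 is irrelevant).
-- |A ∩ {M+1, …, M+N}|
count : (ℕ → Bool) → ℕ → ℕ → ℕ
count A M zero    = zero
count A M (suc N) with A (M ℕ.+ suc N)
... | true  = suc (count A M N)
... | false = count A M N

-- d*(A) > c, where d*(A) = lim_{N→∞} sup_M |A ∩ {M+1..M+N}| / N
-- (the limit exists).  Since the sup is over a finite set of values it is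
-- attained, so lim > c  iff  for some rational η > c, eventually
-- (for all N ≥ N₀) some window of length N has at least η·N elements of A.
UpperBanachDensityGT : (ℕ → Bool) → ℚ → Set
UpperBanachDensityGT A c =
  ∃ λ (η : ℚ) → (c ℚ.< η) × (∃ λ (N₀ : ℕ) → ∀ (N : ℕ) → 1 ℕ.≤ N → N₀ ℕ.≤ N →
    ∃ λ (M : ℕ) → η ℚ.* toℚ (+ N) ℚ.≤ toℚ (+ count A M N))

_∈ℕA_ : ℤ → (ℕ → Bool) → Set
z ∈ℕA A = ∃ λ (n : ℕ) → (z ≡ + suc n) × (A (suc n) ≡ true)

PatternIn : Poly → (ℕ → Set) → ℤ → (ℕ → Bool) → Set
PatternIn P B t A =
  ∀ (b₁ b₂ : ℕ) → 1 ℕ.≤ b₁ → B b₁ → B b₂ → b₁ ℕ.< b₂ →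
  ∀ (k : ℤ) → eval P (toℚ (+ b₁)) ≡ toℚ k →
  ((k ℤ.+ + b₂) ℤ.+ t) ∈ℕA A

Infinite : (ℕ → Set) → Set
Infinite B = ∀ (n : ℕ) → ∃ λ (b : ℕ) → (n ℕ.≤ b) × B b

{-# OPTIONS --safe #-}
module Submission where

-- Let f(x) = P(x) + x + t.  If b₁ ≡ b₂ (mod m) then P(b₁) + b₂ + t ≡ f(b₁)
-- (mod m), and any infinite B contains such pairs with b₂ arbitrarily large.
-- So it suffices to remove from ℕ, for every t, the residue classes that f
-- meets modulo some m = m(t), from some point on, provided that these classes
-- have small density.  By the Chinese remainder theorem and Schur's theorem on
-- prime divisors of the values of Δf, that follows once f misses a fixed
-- proportion of the classes modulo every large prime p for which
-- f(x) ≡ f(x + 1) (mod p) has a solution.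
--
-- For the latter, suppose that f misses s > 0 classes modulo p.  If G is a
-- polynomial with roots at the repeated values of f and at all missed values
-- but one, w, then Σ_x G(f(x)) + G(w) = Σ_v G(v).  If (2s - 1) deg f < p - 1,
-- both sums vanish modulo p, hence so does G(w), which is impossible.

open import Defs
open import Data.Bool using (Bool; true; false; _∧_; _∨_; not)
open import Data.Bool.ListAction using (any)
import Data.Bool.Properties as Bool
open import Data.Fin using (toℕ; fromℕ<)
import Data.Fin.Properties as Fin
open import Data.Integer as ℤ using (ℤ; +_; -[1+_]; 0ℤ; 1ℤ; +≤+; +<+)
open import Data.Integer.Divisibility.Signed as ℤ using (divides) renaming (_∣_ to _∣ℤ_)
import Data.Integer.DivMod as ℤ
import Data.Integer.Properties as ℤ
open import Data.Integer.Tactic.RingSolver using (solve-∀)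
open import Data.List using (List; []; _∷_; _++_; length; map; upTo; applyUpTo; cartesianProductWith)
open import Data.List.Membership.Propositional using (_∈_; _∉_)
import Data.List.Membership.Propositional.Properties as Mem
import Data.List.Properties as List
open import Data.List.Relation.Binary.Permutation.Propositional using (_↭_; ↭-refl; ↭-sym; ↭-trans; ↭⇒↭ₛ; prep; swap)
import Data.List.Relation.Binary.Permutation.Propositional.Properties as Perm
import Data.List.Relation.Binary.Permutation.Setoid.Properties as Permₛ
open import Data.List.Relation.Unary.All as All using (All; []; _∷_)
import Data.List.Relation.Unary.All.Properties as All
open import Data.List.Relation.Unary.Any using (here; there)
open import Data.List.Relation.Unary.Unique.Propositional using (Unique; _∷_)
import Data.List.Relation.Unary.Unique.Propositional.Properties as Unique
open import Data.Nat as ℕ using (ℕ; zero; suc; _+_; _*_; _^_; _≤_; z≤n; s≤s; NonZero; _!)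
open import Data.Nat.Combinatorics using (_C_; nCk≡nC[n∸k]; nCn≡1; k>n⇒nCk≡0; nCk+nC[k+1]≡[n+1]C[k+1])
open import Data.Nat.Coprimality as Coprime using (Coprime; coprime-Bézout; coprime-divisor; prime⇒coprime)
import Data.Nat.Divisibility as ℕ
import Data.Nat.DivMod as ℕ
open import Data.Nat.GCD using (module Bézout)
open import Data.Nat.ListAction using (product)
open import Data.Nat.Primality using (Prime; euclidsLemma; prime⇒nonZero; prime⇒nonTrivial)
open import Data.Nat.Primality.Factorisation using (factorise; module PrimeFactorisation)
import Data.Nat.Properties as ℕ
import Data.Nat.Tactic.RingSolver as ℕ-Solver
open import Data.Product using (∃; ∃₂; _×_; _,_; proj₁; proj₂)
open import Data.Rational as ℚ using (ℚ; mkℚ; 0ℚ; 1ℚ; _<_; _-_)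
import Data.Rational.Properties as ℚ
import Data.Rational.Solver as ℚ-Solver
open import Data.Rational.Unnormalised as ℚᵘ using (mkℚᵘ; *≡*; *≤*; *<*; _≃_)
import Data.Rational.Unnormalised.Properties as ℚᵘ
open import Data.Sum using (_⊎_; inj₁; inj₂; [_,_]′)
open import Function using (_∘_; id)
open import Relation.Binary.Definitions using (tri<; tri≈; tri>)
open import Relation.Binary.PropositionalEquality
open import Relation.Nullary using (¬_; Dec; yes; no; does; contradiction)
open import Relation.Nullary.Decidable using (dec-true; dec-false)

-- Finite differences and binomial coefficients

-- Generic in the two operations, to be used both over ℤ and over ℚ, where the coefficients of `P`
-- live; the interchange law makes differences additive.
module Difference {A : Set} (_⊕_ _⊖_ : A → A → A)
  (interchange : ∀ a b c d → (a ⊕ b) ⊖ (c ⊕ d) ≡ (a ⊖ c) ⊕ (b ⊖ d)) where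

  Δ : (ℕ → A) → ℕ → A
  Δ f n = f (suc n) ⊖ f n

  -- For c = 0 this says that f is a polynomial function of degree less than k.
  ConstDiff : ℕ → A → (ℕ → A) → Set
  ConstDiff zero    c f = ∀ n → f n ≡ c
  ConstDiff (suc k) c f = ConstDiff k c (Δ f)

  constDiff-cong : ∀ k {c f g} → (∀ n → f n ≡ g n) → ConstDiff k c f → ConstDiff k c g
  constDiff-cong zero    f≗g h n = trans (sym (f≗g n)) (h n)
  constDiff-cong (suc k) f≗g h = constDiff-cong k (λ n → cong₂ _⊖_ (f≗g (suc n)) (f≗g n)) h

  constDiff-shift : ∀ k m {c f} → ConstDiff k c f → ConstDiff k c (λ n → f (m + n))
  constDiff-shift zero    m h n = h (m + n)
  constDiff-shift (suc k) m {f = f} h =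
    constDiff-cong k (λ n → cong (λ i → f i ⊖ f (m + n)) (sym (ℕ.+-suc m n))) (constDiff-shift k m h)

  constDiff-+ : ∀ k {c d f g} → ConstDiff k c f → ConstDiff k d g →
    ConstDiff k (c ⊕ d) (λ n → f n ⊕ g n)
  constDiff-+ zero    h h′ n = cong₂ _⊕_ (h n) (h′ n)
  constDiff-+ (suc k) h h′ =
    constDiff-cong k (λ n → sym (interchange _ _ _ _)) (constDiff-+ k h h′)

open Difference ℤ._+_ ℤ._-_ solve-∀

constDiff-suc : ∀ k {c f} → ConstDiff k c f → ConstDiff (suc k) 0ℤ f
constDiff-suc zero    {c} h n = trans (cong₂ ℤ._-_ (h (suc n)) (h n)) (ℤ.+-inverseʳ c)
constDiff-suc (suc k) h = constDiff-suc k h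

constDiff-neg : ∀ k {c f} → ConstDiff k c f → ConstDiff k (ℤ.- c) (λ n → ℤ.- f n)
constDiff-neg zero    h n = cong ℤ.-_ (h n)
constDiff-neg (suc k) {f = f} h = constDiff-cong k (λ n → lemma (f (suc n)) (f n)) (constDiff-neg k h)
  where
  lemma : ∀ a b → ℤ.- (a ℤ.- b) ≡ ℤ.- a ℤ.- (ℤ.- b)
  lemma = solve-∀

constDiff-0 : ∀ k {f} → (∀ n → f n ≡ 0ℤ) → ConstDiff k 0ℤ f
constDiff-0 zero    h = h
constDiff-0 (suc k) h = constDiff-suc k (constDiff-0 k h)

-- Degrees add under products: by the discrete Leibniz rule a difference lowers the degree of one
-- factor at a time, so the induction runs on a + b. The indices are successors because
-- `ConstDiff (suc a) 0ℤ` encodes degree at most a.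
constDiff-* : ∀ a b {f g} → ConstDiff (suc a) 0ℤ f → ConstDiff (suc b) 0ℤ g →
  ConstDiff (suc (a + b)) 0ℤ (λ n → f n ℤ.* g n)
constDiff-* a b {f} {g} hf hg =
  constDiff-cong (a + b) (λ n → leibniz (f (suc n)) (f n) (g (suc n)) (g n))
    (constDiff-+ (a + b) (left a hf) (right b hg))
  where
  leibniz : ∀ f⁺ f g⁺ g → (f⁺ ℤ.- f) ℤ.* g⁺ ℤ.+ f ℤ.* (g⁺ ℤ.- g) ≡ f⁺ ℤ.* g⁺ ℤ.- f ℤ.* g
  leibniz = solve-∀
  left : ∀ a → ConstDiff a 0ℤ (Δ f) → ConstDiff (a + b) 0ℤ (λ n → Δ f n ℤ.* g (suc n))
  left zero    h = constDiff-0 b (λ n → cong (ℤ._* g (suc n)) (h n))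
  left (suc a) h = constDiff-* a b {Δ f} {λ n → g (suc n)} h (constDiff-shift (suc b) 1 {f = g} hg)
  right : ∀ b → ConstDiff b 0ℤ (Δ g) → ConstDiff (a + b) 0ℤ (λ n → f n ℤ.* Δ g n)
  right zero    h = constDiff-0 (a + 0) (λ n → trans (cong (f n ℤ.*_) (h n)) (ℤ.*-zeroʳ (f n)))
  right (suc b) h = subst (λ k → ConstDiff k 0ℤ (λ n → f n ℤ.* Δ g n)) (sym (ℕ.+-suc a b)) (constDiff-* a b {f} {Δ g} hf h)

nC0≡1 : ∀ n → n C 0 ≡ 1
nC0≡1 n = trans (nCk≡nC[n∸k] {0} {n} z≤n) (nCn≡1 n)

-- newton i k f x n = Σ_{j<k} C(n, i + j) Δʲf(x)
newton : ℕ → ℕ → (ℕ → ℤ) → ℕ → ℕ → ℤ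
newton i zero    f x n = 0ℤ
newton i (suc k) f x n = + (n C i) ℤ.* f x ℤ.+ newton (suc i) k (Δ f) x n

newton-0 : ∀ i k f x → newton (suc i) k f x 0 ≡ 0ℤ
newton-0 i zero    f x = refl
newton-0 i (suc k) f x = cong₂ (λ b s → + b ℤ.* f x ℤ.+ s) (k>n⇒nCk≡0 {0} {suc i} (s≤s z≤n)) (newton-0 (suc i) k (Δ f) x)

newton-pascal : ∀ i k f x n → newton (suc i) k f x (suc n) ≡ newton i k f x n ℤ.+ newton (suc i) k f x n
newton-pascal i zero    f x n = refl
newton-pascal i (suc k) f x n = begin
  + (suc n C suc i) ℤ.* f x ℤ.+ newton (2 + i) k (Δ f) x (suc n)
    ≡⟨ cong₂ (λ b s → + b ℤ.* f x ℤ.+ s) (sym (nCk+nC[k+1]≡[n+1]C[k+1] n i)) (newton-pascal (suc i) k (Δ f) x n) ⟩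
  (+ (n C i) ℤ.+ + (n C suc i)) ℤ.* f x ℤ.+ (newton (suc i) k (Δ f) x n ℤ.+ newton (2 + i) k (Δ f) x n)
    ≡⟨ lemma (+ (n C i)) (+ (n C suc i)) (f x) _ _ ⟩
  newton i (suc k) f x n ℤ.+ newton (suc i) (suc k) f x n ∎
  where
  open ≡-Reasoning
  lemma : ∀ a b y s t → (a ℤ.+ b) ℤ.* y ℤ.+ (s ℤ.+ t) ≡ (a ℤ.* y ℤ.+ s) ℤ.+ (b ℤ.* y ℤ.+ t)
  lemma = solve-∀

-- Newton's forward difference formula. Going from n to n + 1 adds Δf(x + n), and Pascal's rule
-- recombines the two expansions.
newton-formula : ∀ k f x → ConstDiff k 0ℤ f → ∀ n → f (x + n) ≡ newton 0 k f x n
newton-formula zero    f x h n = h (x + n)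
newton-formula (suc k) f x h zero = begin
  f (x + 0)                  ≡⟨ cong f (ℕ.+-identityʳ x) ⟩
  f x                        ≡⟨ lemma (f x) ⟩
  1ℤ ℤ.* f x ℤ.+ 0ℤ          ≡⟨ cong₂ (λ b s → + b ℤ.* f x ℤ.+ s) (nC0≡1 0) (newton-0 0 k (Δ f) x) ⟨
  newton 0 (suc k) f x 0     ∎
  where
  open ≡-Reasoning
  lemma : ∀ y → y ≡ 1ℤ ℤ.* y ℤ.+ 0ℤ
  lemma = solve-∀
newton-formula (suc k) f x h (suc n) = begin
  f (x + suc n)
    ≡⟨ cong f (ℕ.+-suc x n) ⟩
  f (suc (x + n))
    ≡⟨ lemma (f (suc (x + n))) (f (x + n)) ⟩
  f (x + n) ℤ.+ Δ f (x + n)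
    ≡⟨ cong₂ ℤ._+_ (newton-formula (suc k) f x h n) (newton-formula k (Δ f) x h n) ⟩
  (+ (n C 0) ℤ.* f x ℤ.+ newton 1 k (Δ f) x n) ℤ.+ newton 0 k (Δ f) x n
    ≡⟨ lemma₂ (+ (n C 0) ℤ.* f x) _ _ ⟩
  + (n C 0) ℤ.* f x ℤ.+ (newton 0 k (Δ f) x n ℤ.+ newton 1 k (Δ f) x n)
    ≡⟨ cong₂ (λ b s → + b ℤ.* f x ℤ.+ s) (trans (nC0≡1 n) (sym (nC0≡1 (suc n)))) (sym (newton-pascal 0 k (Δ f) x n)) ⟩
  newton 0 (suc k) f x (suc n) ∎
  where
  open ≡-Reasoning
  lemma : ∀ a b → a ≡ b ℤ.+ (a ℤ.- b)
  lemma = solve-∀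
  lemma₂ : ∀ a b c → (a ℤ.+ b) ℤ.+ c ≡ a ℤ.+ (c ℤ.+ b)
  lemma₂ = solve-∀

∣newton : ∀ m i k f x n → (∀ j → i ≤ j → j ℕ.< i + k → m ℕ.∣ n C j) → + m ∣ℤ newton i k f x n
∣newton m i zero    f x n h = divides 0ℤ refl
∣newton m i (suc k) f x n h = ℤ.∣m∣n⇒∣m+n
  (ℤ.∣m⇒∣m*n (f x) (ℤ.∣ᵤ⇒∣ {i = + (n C i)} (h i ℕ.≤-refl (ℕ.m<m+n i (s≤s z≤n)))))
  (∣newton m (suc i) k (Δ f) x n λ j i<j j< → h j (ℕ.<⇒≤ i<j) (subst (j ℕ.<_) (sym (ℕ.+-suc i k)) j<))

-- An integer-valued polynomial need not have integer coefficients, so x ≡ y modulo m does not in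
-- general give f(x) ≡ f(y). In Newton's formula, however, f(x + n) - f(x) is an integer combination
-- of the C(n, j) with 1 ≤ j ≤ k.
shift-congruence : ∀ m k f x n → ConstDiff (suc k) 0ℤ f → (∀ j → 1 ≤ j → j ≤ k → m ℕ.∣ n C j) →
  + m ∣ℤ f (x + n) ℤ.- f x
shift-congruence m k f x n h m∣C = subst (+ m ∣ℤ_) (sym eq) (∣newton m 1 k (Δ f) x n λ j 1≤j j<1+k → m∣C j 1≤j (ℕ.≤-pred j<1+k))
  where
  open ≡-Reasoning
  lemma : ∀ a b → (1ℤ ℤ.* a ℤ.+ b) ℤ.- a ≡ b
  lemma = solve-∀
  eq : f (x + n) ℤ.- f x ≡ newton 1 k (Δ f) x n
  eq = begin
    f (x + n) ℤ.- f x ≡⟨ cong (ℤ._- f x) (newton-formula (suc k) f x h n) ⟩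
    newton 0 (suc k) f x n ℤ.- f x ≡⟨ cong (λ b → + b ℤ.* f x ℤ.+ newton 1 k (Δ f) x n ℤ.- f x) (nC0≡1 n) ⟩
    1ℤ ℤ.* f x ℤ.+ newton 1 k (Δ f) x n ℤ.- f x ≡⟨ lemma (f x) _ ⟩
    newton 1 k (Δ f) x n ∎

C-absorb : ∀ n k → suc k * (suc n C suc k) ≡ suc n * (n C k)
C-absorb zero zero = refl
C-absorb zero (suc k) = trans (cong (suc (suc k) *_) (k>n⇒nCk≡0 {1} {2 + k} (s≤s (s≤s z≤n))))
  (trans (ℕ.*-zeroʳ (2 + k)) (sym (cong (1 *_) (k>n⇒nCk≡0 {0} {suc k} (s≤s z≤n)))))
C-absorb (suc n) zero = begin
  1 * (suc (suc n) C 1) ≡⟨ cong (1 *_) (nCk+nC[k+1]≡[n+1]C[k+1] (suc n) 0) ⟨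
  1 * (suc n C 0 + suc n C 1) ≡⟨ ℕ.*-distribˡ-+ 1 (suc n C 0) (suc n C 1) ⟩
  1 * (suc n C 0) + 1 * (suc n C 1) ≡⟨ cong₂ _+_ (cong (1 *_) (nC0≡1 (suc n))) (C-absorb n 0) ⟩
  1 + suc n * (n C 0) ≡⟨ cong (λ c → 1 + suc n * c) (nC0≡1 n) ⟩
  suc (suc n) * 1 ≡⟨ cong (suc (suc n) *_) (nC0≡1 (suc n)) ⟨
  suc (suc n) * (suc n C 0) ∎
  where open ≡-Reasoning
C-absorb (suc n) (suc k) = begin
  suc (suc k) * (suc (suc n) C suc (suc k))
    ≡⟨ cong (suc (suc k) *_) (nCk+nC[k+1]≡[n+1]C[k+1] (suc n) (suc k)) ⟨
  suc (suc k) * (suc n C suc k + suc n C suc (suc k))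
    ≡⟨ lemma₁ k (suc n C suc k) _ ⟩
  suc n C suc k + (suc k * (suc n C suc k) + suc (suc k) * (suc n C suc (suc k)))
    ≡⟨ cong (_+_ (suc n C suc k)) (cong₂ _+_ (C-absorb n k) (C-absorb n (suc k))) ⟩
  suc n C suc k + (suc n * (n C k) + suc n * (n C suc k))
    ≡⟨ cong (_+_ (suc n C suc k)) (ℕ.*-distribˡ-+ (suc n) (n C k) _) ⟨
  suc n C suc k + suc n * (n C k + n C suc k)
    ≡⟨ cong (λ c → suc n C suc k + suc n * c) (nCk+nC[k+1]≡[n+1]C[k+1] n k) ⟩
  suc (suc n) * (suc n C suc k) ∎
  where
  open ≡-Reasoning
  lemma₁ : ∀ k a b → suc (suc k) * (a + b) ≡ a + (suc k * a + suc (suc k) * b)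
  lemma₁ = ℕ-Solver.solve-∀

-- Absorption gives p ∣ j · C(p, j), and p does not divide j.
prime∣pCj : ∀ {p} → Prime p → ∀ j → 1 ≤ j → j ℕ.< p → p ℕ.∣ p C j
prime∣pCj {suc p} pr (suc j) _ j<p with euclidsLemma (suc j) (suc p C suc j) pr (ℕ.divides (p C j) (trans (C-absorb p j) (ℕ.*-comm (suc p) (p C j))))
... | inj₁ p∣j = contradiction (ℕ.∣⇒≤ p∣j) (ℕ.<⇒≱ j<p)
... | inj₂ p∣C = p∣C

-- For n = m · k! > 0, absorption turns the claim into j · m ∣ n · C(n - 1, j - 1), which holds
-- since j divides k!.
∣[m*k!]Cj : ∀ m k j → 1 ≤ j → j ≤ k → m ℕ.∣ (m * k !) C j
∣[m*k!]Cj m k (suc j) _ j<k with m * k ! in eq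
... | zero  = subst (m ℕ.∣_) (sym (k>n⇒nCk≡0 {0} {suc j} (s≤s z≤n))) (m ℕ.∣0)
... | suc n = ℕ.*-cancelˡ-∣ (suc j) (subst (suc j * m ℕ.∣_) (sym (C-absorb n j)) (ℕ.∣m⇒∣m*n (n C j)
    (subst (suc j * m ℕ.∣_) eq (subst (ℕ._∣ m * k !) (ℕ.*-comm m (suc j)) (ℕ.*-monoʳ-∣ m (ℕ.∣-trans (ℕ.m∣m*n (j !)) (ℕ.m≤n⇒m!∣n! j<k)))))))

prime-periodic : ∀ {p} → Prime p → ∀ k f x → k ℕ.< p → ConstDiff (suc k) 0ℤ f → + p ∣ℤ f (x + p) ℤ.- f x
prime-periodic pr k f x k<p h = shift-congruence _ k f x _ h λ j 1≤j j≤k → prime∣pCj pr j 1≤j (ℕ.≤-<-trans j≤k k<p)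

-- Prime divisors of polynomial values

climb : ∀ f N → (∀ n → N ≤ n → 1ℤ ℤ.≤ Δ f n) → ∀ i → f N ℤ.+ + i ℤ.≤ f (N + i)
climb f N h zero = ℤ.≤-reflexive (trans (ℤ.+-identityʳ (f N)) (cong f (sym (ℕ.+-identityʳ N))))
climb f N h (suc i) = begin
  f N ℤ.+ (1ℤ ℤ.+ + i)            ≡⟨ lemma₁ (f N) (+ i) ⟩
  f N ℤ.+ + i ℤ.+ 1ℤ              ≤⟨ ℤ.+-mono-≤ (climb f N h i) (h (N + i) (ℕ.m≤m+n N i)) ⟩
  f (N + i) ℤ.+ Δ f (N + i)       ≡⟨ lemma₂ (f (N + i)) _ ⟩
  f (suc (N + i))                 ≡⟨ cong f (sym (ℕ.+-suc N i)) ⟩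
  f (N + suc i)                   ∎
  where
  open ℤ.≤-Reasoning
  lemma₁ : ∀ a b → a ℤ.+ (1ℤ ℤ.+ b) ≡ a ℤ.+ b ℤ.+ 1ℤ
  lemma₁ = solve-∀
  lemma₂ : ∀ a b → a ℤ.+ (b ℤ.- a) ≡ b
  lemma₂ = solve-∀

i≤+∣i∣ : ∀ i → i ℤ.≤ + ℤ.∣ i ∣
i≤+∣i∣ (+ n)    = ℤ.≤-refl
i≤+∣i∣ -[1+ n ] = ℤ.-≤+

-- Induction on k: Δf is eventually at least 1, either because it equals c > 0 or by the case k - 1,
-- and then f climbs at least linearly.
grows : ∀ k {c f} → ConstDiff (suc k) c f → 0ℤ ℤ.< c → ∀ Y → ∃ λ N → ∀ n → N ≤ n → Y ℤ.≤ f n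
grows k {c} {f} h 0<c Y with eventually-increasing k h
  where
  eventually-increasing : ∀ k → ConstDiff (suc k) c f → ∃ λ N → ∀ n → N ≤ n → 1ℤ ℤ.≤ Δ f n
  eventually-increasing zero    h = 0 , λ n _ → ℤ.≤-trans (ℤ.i<j⇒suc[i]≤j 0<c) (ℤ.≤-reflexive (sym (h n)))
  eventually-increasing (suc k) h = grows k {f = Δ f} h 0<c 1ℤ
... | N , inc = N + a , λ n N+a≤n → begin
  Y                           ≡⟨ lemma Y (f N) ⟩
  f N ℤ.+ (Y ℤ.- f N)         ≤⟨ ℤ.+-monoʳ-≤ (f N) (i≤+∣i∣ (Y ℤ.- f N)) ⟩
  f N ℤ.+ + a                 ≤⟨ ℤ.+-monoʳ-≤ (f N) (+≤+ (ℕ.m+n≤o⇒m≤o∸n a (subst (_≤ n) (ℕ.+-comm N a) N+a≤n))) ⟩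
  f N ℤ.+ + (n ℕ.∸ N)         ≤⟨ climb f N inc (n ℕ.∸ N) ⟩
  f (N + (n ℕ.∸ N))           ≡⟨ cong f (ℕ.m+[n∸m]≡n (ℕ.≤-trans (ℕ.m≤m+n N a) N+a≤n)) ⟩
  f n                         ∎
  where
  open ℤ.≤-Reasoning
  a = ℤ.∣ Y ℤ.- f N ∣
  lemma : ∀ c y → c ≡ y ℤ.+ (c ℤ.- y)
  lemma = solve-∀

prime-divisor : ∀ n → 2 ≤ n → ∃ λ p → Prime p × p ℕ.∣ n
prime-divisor (suc n) 2≤n with PrimeFactorisation.factors fs | PrimeFactorisation.isFactorisation fs | PrimeFactorisation.factorsPrime fs
  where fs = factorise (suc n)
... | []     | eq | _      = contradiction (subst (2 ≤_) eq 2≤n) λ { (s≤s ()) }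
... | p ∷ ps | eq | pr ∷ _ = p , pr , subst (p ℕ.∣_) (sym eq) (ℕ.m∣m*n (product ps))

prime≤⇒∣! : ∀ {p n} → Prime p → p ≤ n → p ℕ.∣ n !
prime≤⇒∣! {suc p} _ p≤n = ℕ.∣-trans (ℕ.m∣m*n (p !)) (ℕ.m≤n⇒m!∣n! p≤n)

-- Schur's argument: the values of g on an arithmetic progression through a
-- point where g takes a value c > 0 are of the form c (1 + M q).
value-coprime-to : ∀ k {c g} → ConstDiff (suc k) c g → 0ℤ ℤ.< c → ∀ M → 1 ≤ M →
  ∃₂ λ x q → 1ℤ ℤ.< 1ℤ ℤ.+ q ℤ.* + M × (1ℤ ℤ.+ q ℤ.* + M) ∣ℤ g x
value-coprime-to k {c} {g} h 0<c M 1≤M = x₀ + n , q , 1<v , divides (g x₀) value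
  where
  positive = grows k {f = g} h 0<c 1ℤ
  x₀ = proj₁ positive
  larger = grows k {f = g} h 0<c (1ℤ ℤ.+ g x₀)
  x₁ = proj₁ larger
  u = ℤ.∣ g x₀ ∣
  -- The factor `u * M` together with the factorial gives g(x₀ + n) ≡ g(x₀) modulo u · M, so that
  -- the quotient by u = g(x₀) is 1 modulo M. The factor x₁ pushes x₀ + n to x₁ or beyond, where g
  -- exceeds g(x₀), so that this quotient is greater than 1.
  n = u * M * x₁ * suc k !
  uM∣ : + (u * M) ∣ℤ g (x₀ + n) ℤ.- g x₀
  uM∣ = shift-congruence (u * M) (suc k) g x₀ n (constDiff-suc (suc k) {f = g} h) λ j 1≤j j≤k →
    ℕ.∣-trans (ℕ.m∣m*n x₁) (∣[m*k!]Cj (u * M * x₁) (suc k) j 1≤j j≤k)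
  q = _∣ℤ_.quotient uM∣
  1≤gx₀ : 1ℤ ℤ.≤ g x₀
  1≤gx₀ = proj₂ positive x₀ ℕ.≤-refl
  +u≡g : + u ≡ g x₀
  +u≡g = ℤ.0≤i⇒+∣i∣≡i (ℤ.≤-trans (+≤+ z≤n) 1≤gx₀)
  1≤u : 1 ≤ u
  1≤u = ℤ.drop‿+≤+ (subst (1ℤ ℤ.≤_) (sym +u≡g) 1≤gx₀)
  x₁≤n : x₁ ≤ x₀ + n
  x₁≤n = begin
    x₁                        ≡⟨ ℕ.*-identityʳ x₁ ⟨
    x₁ * 1                    ≤⟨ ℕ.*-mono-≤ (ℕ.m≤n*m x₁ (u * M) {{ℕ.>-nonZero (ℕ.*-mono-≤ 1≤u 1≤M)}}) (ℕ.1≤n! (suc k)) ⟩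
    u * M * x₁ * suc k !      ≤⟨ ℕ.m≤n+m n x₀ ⟩
    x₀ + n                    ∎
    where open ℕ.≤-Reasoning
  value : g (x₀ + n) ≡ g x₀ ℤ.* (1ℤ ℤ.+ q ℤ.* + M)
  value = begin
    g (x₀ + n)                             ≡⟨ lemma₁ (g (x₀ + n)) (g x₀) ⟩
    g x₀ ℤ.+ (g (x₀ + n) ℤ.- g x₀)         ≡⟨ cong (ℤ._+_ (g x₀)) (_∣ℤ_.equality uM∣) ⟩
    g x₀ ℤ.+ q ℤ.* + (u * M)               ≡⟨ cong (λ w → g x₀ ℤ.+ q ℤ.* w) (trans (ℤ.pos-* u M) (cong (ℤ._* + M) +u≡g)) ⟩
    g x₀ ℤ.+ q ℤ.* (g x₀ ℤ.* + M)          ≡⟨ lemma₂ (g x₀) q (+ M) ⟩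
    g x₀ ℤ.* (1ℤ ℤ.+ q ℤ.* + M)            ∎
    where
    open ≡-Reasoning
    lemma₁ : ∀ a b → a ≡ b ℤ.+ (a ℤ.- b)
    lemma₁ = solve-∀
    lemma₂ : ∀ a q w → a ℤ.+ q ℤ.* (a ℤ.* w) ≡ a ℤ.* (1ℤ ℤ.+ q ℤ.* w)
    lemma₂ = solve-∀
  1<v : 1ℤ ℤ.< 1ℤ ℤ.+ q ℤ.* + M
  1<v = ℤ.*-cancelˡ-<-nonNeg (+ u) (begin-strict
    + u ℤ.* 1ℤ                     ≡⟨ ℤ.*-identityʳ (+ u) ⟩
    + u                            ≡⟨ +u≡g ⟩
    g x₀                           <⟨ ℤ.suc[i]≤j⇒i<j (proj₂ larger (x₀ + n) x₁≤n) ⟩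
    g (x₀ + n)                     ≡⟨ value ⟩
    g x₀ ℤ.* (1ℤ ℤ.+ q ℤ.* + M)    ≡⟨ cong (ℤ._* (1ℤ ℤ.+ q ℤ.* + M)) +u≡g ⟨
    + u ℤ.* (1ℤ ℤ.+ q ℤ.* + M)     ∎)
    where open ℤ.≤-Reasoning

prime-divisorℤ : ∀ v → 1ℤ ℤ.< v → ∃ λ p → Prime p × + p ∣ℤ v
prime-divisorℤ (+ n) (+<+ 1<n) with prime-divisor n 1<n
... | p , pr , p∣n = p , pr , ℤ.∣ᵤ⇒∣ {i = + n} p∣n

prime∤1+q*M : ∀ {p} q M → Prime p → p ℕ.∣ M → ¬ (+ p ∣ℤ 1ℤ ℤ.+ q ℤ.* + M)
prime∤1+q*M {p} q M pr p∣M p∣v = contradiction (ℕ.∣⇒≤ (ℤ.∣⇒∣ᵤ p∣1)) (ℕ.<⇒≱ (ℕ.nonTrivial⇒n>1 p {{prime⇒nonTrivial pr}}))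
  where
  p∣1 : + p ∣ℤ 1ℤ
  p∣1 = ℤ.∣m+n∣n⇒∣m p∣v (ℤ.∣n⇒∣m*n q (ℤ.∣ᵤ⇒∣ {i = + M} p∣M))

-- With M = Q! the factor 1 + q · M is coprime to every prime up to Q, so any prime divisor of it
-- exceeds Q.
large-prime-divisor⁺ : ∀ k {c g} → ConstDiff (suc k) c g → 0ℤ ℤ.< c → ∀ Q →
  ∃₂ λ p x → Prime p × Q ℕ.< p × + p ∣ℤ g x
large-prime-divisor⁺ k {g = g} h 0<c Q =
  p , x , pr , ℕ.≰⇒> (λ p≤Q → prime∤1+q*M q (Q !) pr (prime≤⇒∣! pr p≤Q) p∣v) , ℤ.∣-trans p∣v v∣g
  where
  val = value-coprime-to k {g = g} h 0<c (Q !) (ℕ.1≤n! Q)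
  x = proj₁ val
  q = proj₁ (proj₂ val)
  v∣g = proj₂ (proj₂ (proj₂ val))
  div = prime-divisorℤ (1ℤ ℤ.+ q ℤ.* + (Q !)) (proj₁ (proj₂ (proj₂ val)))
  p = proj₁ div
  pr = proj₁ (proj₂ div)
  p∣v = proj₂ (proj₂ div)

large-prime-divisor : ∀ k {c g} → ConstDiff (suc k) c g → c ≢ 0ℤ → ∀ Q →
  ∃₂ λ p x → Prime p × Q ℕ.< p × + p ∣ℤ g x
large-prime-divisor k {c} {g} h c≢0 Q with ℤ.<-cmp 0ℤ c
... | tri< 0<c _ _ = large-prime-divisor⁺ k {c} {g} h 0<c Q
... | tri≈ _ 0≡c _ = contradiction (sym 0≡c) c≢0
... | tri> _ _ c<0 = negated
  (large-prime-divisor⁺ k {ℤ.- c} {λ n → ℤ.- g n} (constDiff-neg (suc k) {c} {g} h) (ℤ.neg-mono-< c<0) Q)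
  where
  negated : (∃₂ λ p x → Prime p × Q ℕ.< p × + p ∣ℤ ℤ.- g x) → ∃₂ λ p x → Prime p × Q ℕ.< p × + p ∣ℤ g x
  negated (p , x , pr , Q<p , p∣) = p , x , pr , Q<p , subst (+ p ∣ℤ_) (ℤ.neg-involutive (g x)) (ℤ.∣m⇒∣-m p∣)

-- Values modulo a prime

∣-flip : ∀ {m a b} → m ∣ℤ a ℤ.- b → m ∣ℤ b ℤ.- a
∣-flip {m} {a} {b} h = subst (m ∣ℤ_) (lemma a b) (ℤ.∣m⇒∣-m h)
  where
  lemma : ∀ a b → ℤ.- (a ℤ.- b) ≡ b ℤ.- a
  lemma = solve-∀

∣-chain : ∀ {m a b c} → m ∣ℤ a ℤ.- b → m ∣ℤ b ℤ.- c → m ∣ℤ a ℤ.- c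
∣-chain {m} {a} {b} {c} h h′ = subst (m ∣ℤ_) (lemma a b c) (ℤ.∣m∣n⇒∣m+n h h′)
  where
  lemma : ∀ a b c → (a ℤ.- b) ℤ.+ (b ℤ.- c) ≡ a ℤ.- c
  lemma = solve-∀

congruent⇒≡ : ∀ {m a b} → a ℕ.< m → b ℕ.< m → + m ∣ℤ + a ℤ.- + b → a ≡ b
congruent⇒≡ {m} {a} {b} a<m b<m h = [ (λ b≤a → le b≤a a<m h) , (λ a≤b → sym (le a≤b b<m (∣-flip {a = + a} {+ b} h))) ]′ (ℕ.≤-total b a)
  where
  le : ∀ {a b} → b ≤ a → a ℕ.< m → + m ∣ℤ + a ℤ.- + b → a ≡ b
  le {a} {b} b≤a a<m h with a ℕ.∸ b in eq | subst (m ℕ.∣_) (cong ℤ.∣_∣ (trans (ℤ.m-n≡m⊖n a b) (ℤ.⊖-≥ b≤a))) (ℤ.∣⇒∣ᵤ h)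
  ... | zero  | _   = ℕ.≤-antisym (ℕ.m∸n≡0⇒m≤n eq) b≤a
  ... | suc i | m∣i = contradiction (ℕ.≤-trans (ℕ.∣⇒≤ m∣i) (subst (_≤ a) eq (ℕ.m∸n≤m a b))) (ℕ.<⇒≱ a<m)

prefixSum : (ℕ → ℤ) → ℕ → ℤ
prefixSum h zero    = 0ℤ
prefixSum h (suc n) = prefixSum h n ℤ.+ h n

prefixSum-front : ∀ h n → prefixSum h (suc n) ≡ h 0 ℤ.+ prefixSum (λ i → h (suc i)) n
prefixSum-front h zero    = ℤ.+-comm 0ℤ (h 0)
prefixSum-front h (suc n) = trans (cong (ℤ._+ h (suc n)) (prefixSum-front h n)) (ℤ.+-assoc (h 0) _ (h (suc n)))

-- The prefix sum S has difference h, hence is a polynomial function of degree one more, and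
-- periodicity gives S(p) ≡ S(0) = 0. This takes the place of evaluating power sums modulo p.
prime∣prefixSum : ∀ {p} → Prime p → ∀ k h → suc k ℕ.< p → ConstDiff (suc k) 0ℤ h → + p ∣ℤ prefixSum h p
prime∣prefixSum {p} pr k h k<p d = subst (+ p ∣ℤ_) (ℤ.+-identityʳ (prefixSum h p))
  (prime-periodic pr (suc k) (prefixSum h) 0 k<p (constDiff-cong (suc k) {f = h} (λ n → lemma (prefixSum h n) (h n)) d))
  where
  lemma : ∀ a b → b ≡ (a ℤ.+ b) ℤ.- a
  lemma = solve-∀

∣prefixSum-cong : ∀ {m} h h′ → (∀ x → m ∣ℤ h x ℤ.- h′ x) → ∀ n → m ∣ℤ prefixSum h n → m ∣ℤ prefixSum h′ n
∣prefixSum-cong {m} h h′ h≈h′ n m∣h =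
  subst (m ∣ℤ_) (lemma (prefixSum h n) (prefixSum h′ n)) (ℤ.∣m∣n⇒∣m-n m∣h (difference n))
  where
  lemma : ∀ a b → a ℤ.- (a ℤ.- b) ≡ b
  lemma = solve-∀
  lemma₂ : ∀ a b c d → (a ℤ.- b) ℤ.+ (c ℤ.- d) ≡ (a ℤ.+ c) ℤ.- (b ℤ.+ d)
  lemma₂ = solve-∀
  difference : ∀ n → m ∣ℤ prefixSum h n ℤ.- prefixSum h′ n
  difference zero    = divides 0ℤ refl
  difference (suc n) = subst (m ∣ℤ_) (lemma₂ (prefixSum h n) (prefixSum h′ n) (h n) (h′ n)) (ℤ.∣m∣n⇒∣m+n (difference n) (h≈h′ n))

-- Sums over lists and polynomials with given roots

sumOver : (ℕ → ℤ) → List ℕ → ℤ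
sumOver G []       = 0ℤ
sumOver G (x ∷ xs) = G x ℤ.+ sumOver G xs

module _ (G : ℕ → ℤ) where

  sumOver-++ : ∀ xs ys → sumOver G (xs ++ ys) ≡ sumOver G xs ℤ.+ sumOver G ys
  sumOver-++ []       ys = sym (ℤ.+-identityˡ (sumOver G ys))
  sumOver-++ (x ∷ xs) ys = trans (cong (ℤ._+_ (G x)) (sumOver-++ xs ys)) (sym (ℤ.+-assoc (G x) _ _))

  sumOver-↭ : ∀ {xs ys} → xs ↭ ys → sumOver G xs ≡ sumOver G ys
  sumOver-↭ _↭_.refl         = refl
  sumOver-↭ (prep x p)       = cong (ℤ._+_ (G x)) (sumOver-↭ p)
  sumOver-↭ (swap {xs} x y p) = trans (lemma (G x) (G y) (sumOver G xs)) (cong (λ s → G y ℤ.+ (G x ℤ.+ s)) (sumOver-↭ p))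
    where
    lemma : ∀ a b c → a ℤ.+ (b ℤ.+ c) ≡ b ℤ.+ (a ℤ.+ c)
    lemma = solve-∀
  sumOver-↭ (_↭_.trans p q)  = trans (sumOver-↭ p) (sumOver-↭ q)

  sumOver-0 : ∀ {xs} → All (λ x → G x ≡ 0ℤ) xs → sumOver G xs ≡ 0ℤ
  sumOver-0 []       = refl
  sumOver-0 (h ∷ hs) = cong₂ ℤ._+_ h (sumOver-0 hs)

  sumOver-applyUpTo : ∀ l n → sumOver G (applyUpTo l n) ≡ prefixSum (λ i → G (l i)) n
  sumOver-applyUpTo l zero    = refl
  sumOver-applyUpTo l (suc n) = trans (cong (ℤ._+_ (G (l 0))) (sumOver-applyUpTo (l ∘ suc) n)) (sym (prefixSum-front (λ i → G (l i)) n))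

rootPoly : List ℕ → ℤ → ℤ
rootPoly []       x = 1ℤ
rootPoly (z ∷ zs) x = (x ℤ.- + z) ℤ.* rootPoly zs x

rootPoly-root : ∀ {zs z} → z ∈ zs → rootPoly zs (+ z) ≡ 0ℤ
rootPoly-root {y ∷ zs} (here refl)  = cong (ℤ._* rootPoly zs (+ y)) (ℤ.+-inverseʳ (+ y))
rootPoly-root {y ∷ zs} {z} (there z∈) = trans (cong ((+ z ℤ.- + y) ℤ.*_) (rootPoly-root z∈)) (ℤ.*-zeroʳ (+ z ℤ.- + y))

rootPoly-cong : ∀ {m} zs x y → m ∣ℤ x ℤ.- y → m ∣ℤ rootPoly zs x ℤ.- rootPoly zs y
rootPoly-cong []       x y h = divides 0ℤ refl
rootPoly-cong {m} (z ∷ zs) x y h = subst (m ∣ℤ_) (lemma x y (+ z) (rootPoly zs x) (rootPoly zs y))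
  (ℤ.∣m∣n⇒∣m+n (ℤ.∣m⇒∣m*n (rootPoly zs x) h) (ℤ.∣n⇒∣m*n (y ℤ.- + z) (rootPoly-cong zs x y h)))
  where
  lemma : ∀ x y z a b → (x ℤ.- y) ℤ.* a ℤ.+ (y ℤ.- z) ℤ.* (a ℤ.- b) ≡ (x ℤ.- z) ℤ.* a ℤ.- (y ℤ.- z) ℤ.* b
  lemma = solve-∀

euclidsLemmaℤ : ∀ {p} → Prime p → ∀ i j → + p ∣ℤ i ℤ.* j → + p ∣ℤ i ⊎ + p ∣ℤ j
euclidsLemmaℤ {p} pr i j h with euclidsLemma ℤ.∣ i ∣ ℤ.∣ j ∣ pr (subst (p ℕ.∣_) (ℤ.abs-* i j) (ℤ.∣⇒∣ᵤ h))
... | inj₁ p∣i = inj₁ (ℤ.∣ᵤ⇒∣ p∣i)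
... | inj₂ p∣j = inj₂ (ℤ.∣ᵤ⇒∣ p∣j)

prime∣rootPoly : ∀ {p} → Prime p → ∀ zs x → + p ∣ℤ rootPoly zs x → ∃ λ z → z ∈ zs × + p ∣ℤ x ℤ.- + z
prime∣rootPoly {p} pr []       x h = contradiction (ℕ.∣⇒≤ (ℤ.∣⇒∣ᵤ h)) (ℕ.<⇒≱ (ℕ.nonTrivial⇒n>1 p {{prime⇒nonTrivial pr}}))
prime∣rootPoly pr (z ∷ zs) x h with euclidsLemmaℤ pr (x ℤ.- + z) (rootPoly zs x) h
... | inj₁ h₁ = z , here refl , h₁
... | inj₂ h₂ with prime∣rootPoly pr zs x h₂
...   | y , y∈ , h₃ = y , there y∈ , h₃

constDiff-rootPoly : ∀ d {φ} zs → ConstDiff (suc d) 0ℤ φ →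
  ConstDiff (suc (length zs * d)) 0ℤ (λ n → rootPoly zs (φ n))
constDiff-rootPoly d {φ} []       h = λ n → refl
constDiff-rootPoly d {φ} (z ∷ zs) h = constDiff-* d (length zs * d) {λ n → φ n ℤ.- + z} {λ n → rootPoly zs (φ n)}
  (constDiff-cong d (λ n → lemma (φ (suc n)) (φ n) (+ z)) h) (constDiff-rootPoly d {φ} zs h)
  where
  lemma : ∀ a b c → a ℤ.- b ≡ (a ℤ.- c) ℤ.- (b ℤ.- c)
  lemma = solve-∀

-- Attained, repeated and missed values

Unique-resp-↭ : ∀ {xs ys : List ℕ} → xs ↭ ys → Unique xs → Unique ys
Unique-resp-↭ p = Permₛ.Unique-resp-↭ (setoid ℕ) (↭⇒↭ₛ p)

-- R lists the values of L once each, D the repetitions, Z the missed values.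
record Sorted (n : ℕ) (L : List ℕ) : Set where
  field
    R D Z  : List ℕ
    L↭R++D : L ↭ R ++ D
    R++Z↭  : R ++ Z ↭ upTo n
    D⊆R    : All (_∈ R) D

sorted : ∀ {n} L → All (ℕ._< n) L → Sorted n L
sorted [] [] = record { R = []; D = []; Z = upTo _; L↭R++D = ↭-refl; R++Z↭ = ↭-refl; D⊆R = [] }
sorted {n} (x ∷ L) (x<n ∷ L<n) with sorted L L<n
... | record { R = R; D = D; Z = Z; L↭R++D = L↭; R++Z↭ = Z↭; D⊆R = D⊆R }
  with Mem.∈-++⁻ R (Perm.∈-resp-↭ (↭-sym Z↭) (Mem.∈-upTo⁺ x<n))
... | inj₁ x∈R = record { R = R; D = x ∷ D; Z = Z; L↭R++D = ↭-trans (prep x L↭) (↭-sym (Perm.shift x R D)); R++Z↭ = Z↭; D⊆R = x∈R ∷ D⊆R }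
... | inj₂ x∈Z with Mem.∈-∃++ x∈Z
...   | Z₁ , Z₂ , refl = record
  { R = x ∷ R; D = D; Z = Z₁ ++ Z₂; L↭R++D = prep x L↭
  ; R++Z↭ = ↭-trans (↭-trans (↭-sym (Perm.shift x R (Z₁ ++ Z₂))) (Perm.++⁺ˡ R (↭-sym (Perm.shift x Z₁ Z₂)))) Z↭
  ; D⊆R = All.map there D⊆R }

module _ {n L} (S : Sorted n L) (|L|≡n : length L ≡ n) where
  open Sorted S

  |R|+|Z| : length R + length Z ≡ n
  |R|+|Z| = trans (sym (List.length-++ R)) (trans (Perm.↭-length R++Z↭) (List.length-upTo n))

  -- Both complete R to a list of length n, so repetitions and missed values balance.
  |D|≡|Z| : length D ≡ length Z
  |D|≡|Z| = ℕ.+-cancelˡ-≡ (length R) _ _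
    (trans (trans (sym (List.length-++ R)) (trans (sym (Perm.↭-length L↭R++D)) |L|≡n)) (sym |R|+|Z|))

  Z-empty⇒unique : Z ≡ [] → Unique L
  -- D and Z become variables so that Z = [] can be matched on; the lengths then force D = [] as
  -- well.
  Z-empty⇒unique = helper D Z |D|≡|Z| L↭R++D R++Z↭
    where
    helper : ∀ D Z → length D ≡ length Z → L ↭ R ++ D → R ++ Z ↭ upTo n → Z ≡ [] → Unique L
    helper [] [] _ L↭ Z↭ refl = Unique-resp-↭ (↭-sym (↭-trans L↭ Z↭)) (Unique.upTo⁺ n)

  -- G vanishes on D and Z′, so both sides reduce to the sum over R plus G w.
  sumOver-sorted : ∀ G w {Z′} → Z ≡ w ∷ Z′ → (∀ {x} → x ∈ D ++ Z′ → G x ≡ 0ℤ) →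
    sumOver G L ℤ.+ G w ≡ sumOver G (upTo n)
  sumOver-sorted G w {Z′} eq G≡0 = begin
    sumOver G L ℤ.+ G w
      ≡⟨ cong (ℤ._+ G w) (trans (sumOver-↭ G L↭R++D) (sumOver-++ G R D)) ⟩
    sumOver G R ℤ.+ sumOver G D ℤ.+ G w
      ≡⟨ cong (λ s → sumOver G R ℤ.+ s ℤ.+ G w) (trans (zero-sum D Mem.∈-++⁺ˡ) (sym (zero-sum Z′ (Mem.∈-++⁺ʳ D)))) ⟩
    sumOver G R ℤ.+ sumOver G Z′ ℤ.+ G w
      ≡⟨ lemma (sumOver G R) (sumOver G Z′) (G w) ⟩
    sumOver G R ℤ.+ sumOver G (w ∷ Z′)
      ≡⟨ cong (λ Z → sumOver G R ℤ.+ sumOver G Z) (sym eq) ⟩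
    sumOver G R ℤ.+ sumOver G Z
      ≡⟨ trans (sym (sumOver-++ G R Z)) (sumOver-↭ G R++Z↭) ⟩
    sumOver G (upTo n) ∎
    where
    open ≡-Reasoning
    zero-sum : ∀ xs → (∀ {x} → x ∈ xs → x ∈ D ++ Z′) → sumOver G xs ≡ 0ℤ
    zero-sum xs xs⊆ = sumOver-0 G (All.tabulate λ x∈ → G≡0 (xs⊆ x∈))
    lemma : ∀ a b c → a ℤ.+ b ℤ.+ c ≡ a ℤ.+ (c ℤ.+ b)
    lemma = solve-∀

  -- R followed by Z has no duplicates, and D only repeats elements of R.
  missed-fresh : ∀ {w Z′} → Z ≡ w ∷ Z′ → w ∉ D ++ Z′
  missed-fresh {w} {Z′} eq w∈ 
    with Unique-resp-↭ (↭-sym (↭-trans (subst (λ Z → w ∷ R ++ Z′ ↭ R ++ Z) (sym eq) (↭-sym (Perm.shift w R Z′))) R++Z↭))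
           (Unique.upTo⁺ n)
  ... | w≢ ∷ _ with Mem.∈-++⁻ D w∈
  ...   | inj₁ w∈D = All.lookup w≢ (Mem.∈-++⁺ˡ (All.lookup D⊆R w∈D)) refl
  ...   | inj₂ w∈Z = All.lookup w≢ (Mem.∈-++⁺ʳ R w∈Z) refl

-- The value set of a polynomial modulo a prime

module _ {p} (pr : Prime p) (d : ℕ) {φ : ℕ → ℤ} (1≤d : 1 ≤ d) (hφ : ConstDiff (suc d) 0ℤ φ) where

  private instance
    p≢0 : NonZero p
    p≢0 = prime⇒nonZero pr

  residue : ℕ → ℕ
  residue x = φ x ℤ.%ℕ p

  residue-cong : ∀ x → + p ∣ℤ φ x ℤ.- + residue x
  residue-cong x = divides (φ x ℤ./ℕ p) (trans (cong (ℤ._- + residue x) (ℤ.a≡a%ℕn+[a/ℕn]*n (φ x) p)) (lemma (+ residue x) _))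
    where
    lemma : ∀ a b → (a ℤ.+ b) ℤ.- a ≡ b
    lemma = solve-∀

  residues : List ℕ
  residues = applyUpTo residue p

  sorted-residues : Sorted p residues
  sorted-residues = sorted residues (All.applyUpTo⁺₂ residue p (λ x → ℤ.n%ℕd<d (φ x) p))

  open Sorted sorted-residues

  |residues|≡p : length residues ≡ p
  |residues|≡p = List.length-applyUpTo residue p

  -- Take G with roots D ++ Z′. If its composite with φ had degree below p - 1, the sums of G over
  -- the values of φ and over all residues would both vanish modulo p, so p would divide G(w). Then
  -- p would divide some w - z with z a root, but w differs from every root and all of them lie
  -- below p.
  many-missed : ∀ {w Z′} → Z ≡ w ∷ Z′ → p ≤ suc (length (D ++ Z′) * d)
  many-missed {w} {Z′} eq = ℕ.≮⇒≥ λ deg<p → impossible deg<p (prime∣rootPoly pr E (+ w) (p∣Gw deg<p))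
    where
    E = D ++ Z′
    G : ℕ → ℤ
    G v = rootPoly E (+ v)
    p∣ΣL : suc (length E * d) ℕ.< p → + p ∣ℤ sumOver G residues
    p∣ΣL deg<p = subst (+ p ∣ℤ_) (sym (sumOver-applyUpTo G residue p))
      (∣prefixSum-cong (λ x → rootPoly E (φ x)) (λ x → G (residue x)) (λ x → rootPoly-cong E (φ x) (+ residue x) (residue-cong x)) p
        (prime∣prefixSum pr (length E * d) (λ x → rootPoly E (φ x)) deg<p (constDiff-rootPoly d {φ} E hφ)))
    p∣Σv : suc (length E * d) ℕ.< p → + p ∣ℤ sumOver G (upTo p)
    p∣Σv deg<p = subst (+ p ∣ℤ_) (sym (sumOver-applyUpTo G id p))
      -- Over all residues the composite is with the identity; its degree `length E` is at most
      -- `length E * d` because d ≥ 1.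
      (prime∣prefixSum pr (length E * 1) G (ℕ.≤-<-trans (s≤s (ℕ.*-monoʳ-≤ (length E) 1≤d)) deg<p) (constDiff-rootPoly 1 {λ n → + n} E ι-linear))
      where
      ι-linear : ConstDiff 2 0ℤ (λ n → + n)
      ι-linear n = lemma (+ n)
        where
        lemma : ∀ n → (1ℤ ℤ.+ (1ℤ ℤ.+ n) ℤ.- (1ℤ ℤ.+ n)) ℤ.- (1ℤ ℤ.+ n ℤ.- n) ≡ 0ℤ
        lemma = solve-∀
    p∣Gw : suc (length E * d) ℕ.< p → + p ∣ℤ G w
    p∣Gw deg<p = ℤ.∣m+n∣m⇒∣n
      (subst (+ p ∣ℤ_) (sym (sumOver-sorted sorted-residues |residues|≡p G w eq rootPoly-root)) (p∣Σv deg<p))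
      (p∣ΣL deg<p)
    <p : ∀ {z} → z ∈ R ++ Z → z ℕ.< p
    <p z∈ = Mem.∈-upTo⁻ (Perm.∈-resp-↭ R++Z↭ z∈)
    E⊆ : ∀ {z} → z ∈ E → z ∈ R ++ Z
    E⊆ {z} z∈ = [ (λ z∈D → Mem.∈-++⁺ˡ (All.lookup D⊆R z∈D))
                , (λ z∈Z → Mem.∈-++⁺ʳ R (subst (z ∈_) (sym eq) (there z∈Z))) ]′ (Mem.∈-++⁻ D z∈)
    impossible : suc (length E * d) ℕ.< p → ¬ (∃ λ z → z ∈ E × + p ∣ℤ + w ℤ.- + z)
    impossible _ (z , z∈E , p∣w-z) = missed-fresh sorted-residues |residues|≡p eq (subst (_∈ E)
      (sym (congruent⇒≡ (<p (Mem.∈-++⁺ʳ R (subst (w ∈_) (sym eq) (here refl)))) (<p (E⊆ z∈E)) p∣w-z)) z∈E)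

  -- The inequality says that at most (1 - 1/(2d)) p classes are attained, without subtraction or
  -- division. The collision makes `residues` repeat a value, so some class is missed, and
  -- `many-missed` then bounds the number of missed classes from below.
  few-residues : + p ∣ℤ φ 1 ℤ.- φ 0 → length R * (2 * d) + p ≤ 2 * d * p
  few-residues collision = helper Z refl
    where
    l₀≡l₁ : residue 0 ≡ residue 1
    l₀≡l₁ = congruent⇒≡ (ℤ.n%ℕd<d (φ 0) p) (ℤ.n%ℕd<d (φ 1) p)
      (∣-chain {a = + residue 0} {φ 0} {+ residue 1} (∣-flip {a = φ 0} {+ residue 0} (residue-cong 0))
        (∣-chain {a = φ 0} {φ 1} {+ residue 1} (∣-flip {a = φ 1} {φ 0} collision) (residue-cong 1)))
    not-unique : ¬ Unique residues
    not-unique u = ne p (ℕ.nonTrivial⇒n>1 p {{prime⇒nonTrivial pr}}) u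
      where
      ne : ∀ n → 1 ℕ.< n → ¬ Unique (applyUpTo residue n)
      ne (suc (suc n)) _ ((l≢ ∷ _) ∷ _) = l≢ l₀≡l₁
      ne (suc zero) (s≤s ())
    helper : ∀ Z₀ → Z ≡ Z₀ → length R * (2 * d) + p ≤ 2 * d * p
    helper []       eq = contradiction (Z-empty⇒unique sorted-residues |residues|≡p eq) not-unique
    helper (w ∷ Z′) eq = begin
      r * (2 * d) + p                              ≤⟨ ℕ.+-monoʳ-≤ (r * (2 * d)) (many-missed eq) ⟩
      r * (2 * d) + suc (length (D ++ Z′) * d)     ≡⟨ cong (λ e → r * (2 * d) + suc (e * d)) |E| ⟩
      -- Replacing 1 by d ≥ 1 turns the bound into p ≤ 2d(s + 1), where s + 1 is the number of
      -- missed classes.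
      r * (2 * d) + (1 + (s + s + 1) * d)          ≤⟨ ℕ.+-monoʳ-≤ (r * (2 * d)) (ℕ.+-monoˡ-≤ ((s + s + 1) * d) 1≤d) ⟩
      r * (2 * d) + (d + (s + s + 1) * d)          ≡⟨ lemma r s d ⟩
      2 * d * (r + suc s)                          ≡⟨ cong (λ n → 2 * d * (r + n)) (sym (cong length eq)) ⟩
      2 * d * (r + length Z)                       ≡⟨ cong (2 * d *_) (|R|+|Z| sorted-residues |residues|≡p) ⟩
      2 * d * p                                    ∎
      where
      open ℕ.≤-Reasoning
      r = length R
      s = length Z′
      |E| : length (D ++ Z′) ≡ s + s + 1
      |E| = trans (List.length-++ D) (trans (cong (_+ s) (trans (|D|≡|Z| sorted-residues |residues|≡p) (cong length eq)))
        (ℕ.+-comm 1 (s + s)))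
      lemma : ∀ r s d → r * (2 * d) + (d + (s + s + 1) * d) ≡ 2 * d * (r + suc s)
      lemma = ℕ-Solver.solve-∀

  residue∈R : ∀ x → x ℕ.< p → residue x ∈ R
  residue∈R x x<p = [ id , All.lookup D⊆R ]′ (Mem.∈-++⁻ R (Perm.∈-resp-↭ L↭R++D (Mem.∈-applyUpTo⁺ residue x<p)))

-- Sparse sets of residue classes

Covers : ℕ → List ℤ → (ℕ → ℤ) → Set
Covers m R f = ∀ x → ∃ λ r → r ∈ R × + m ∣ℤ f x ℤ.- r

-- The Chinese remainder idempotent: up to sign, the multiple of m in a Bézout relation.
idempotent : ∀ {m p} → Coprime m p → ∃ λ e → + m ∣ℤ e × + p ∣ℤ e ℤ.- 1ℤ
idempotent {m} {p} c with coprime-Bézout c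
... | Bézout.+- x y eq = + x ℤ.* + m , divides (+ x) refl , divides (+ y) (begin
  + x ℤ.* + m ℤ.- 1ℤ            ≡⟨ cong (ℤ._- 1ℤ) (ℤ.pos-* x m) ⟨
  + (x * m) ℤ.- 1ℤ              ≡⟨ cong (λ n → + n ℤ.- 1ℤ) (sym eq) ⟩
  1ℤ ℤ.+ + (y * p) ℤ.- 1ℤ       ≡⟨ lemma (+ (y * p)) ⟩
  + (y * p)                     ≡⟨ ℤ.pos-* y p ⟩
  + y ℤ.* + p                   ∎)
  where
  open ≡-Reasoning
  lemma : ∀ a → 1ℤ ℤ.+ a ℤ.- 1ℤ ≡ a
  lemma = solve-∀
... | Bézout.-+ x y eq = ℤ.- + x ℤ.* + m , divides (ℤ.- + x) refl , divides (ℤ.- + y) (begin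
  ℤ.- + x ℤ.* + m ℤ.- 1ℤ        ≡⟨ lemma (+ x) (+ m) ⟩
  ℤ.- (1ℤ ℤ.+ + x ℤ.* + m)      ≡⟨ cong (λ n → ℤ.- (1ℤ ℤ.+ n)) (ℤ.pos-* x m) ⟨
  ℤ.- + (1 + x * m)             ≡⟨ cong (λ n → ℤ.- + n) eq ⟩
  ℤ.- + (y * p)                 ≡⟨ cong ℤ.-_ (ℤ.pos-* y p) ⟩
  ℤ.- (+ y ℤ.* + p)             ≡⟨ ℤ.neg-distribˡ-* (+ y) (+ p) ⟩
  ℤ.- + y ℤ.* + p               ∎)
  where
  open ≡-Reasoning
  lemma : ∀ a b → ℤ.- a ℤ.* b ℤ.- 1ℤ ≡ ℤ.- (1ℤ ℤ.+ a ℤ.* b)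
  lemma = solve-∀

coprime-∣ : ∀ {m p i} → Coprime m p → + m ∣ℤ i → + p ∣ℤ i → + (m * p) ∣ℤ i
coprime-∣ {m} {p} {i} c m∣i p∣i with ℤ.∣⇒∣ᵤ m∣i
... | ℕ.divides q eq = ℤ.∣ᵤ⇒∣ (subst (m * p ℕ.∣_) (sym eq′)
    (ℕ.*-monoʳ-∣ m (coprime-divisor (Coprime.sym c) (subst (p ℕ.∣_) eq′ (ℤ.∣⇒∣ᵤ p∣i)))))
  where
  eq′ : ℤ.∣ i ∣ ≡ m * q
  eq′ = trans eq (ℕ.*-comm q m)

length-cartesianProductWith : ∀ {A B C : Set} (g : A → B → C) xs ys →
  length (cartesianProductWith g xs ys) ≡ length xs * length ys
length-cartesianProductWith g []       ys = refl
length-cartesianProductWith g (x ∷ xs) ys = trans (List.length-++ (map (g x) ys))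
  (cong₂ _+_ (List.length-map (g x) ys) (length-cartesianProductWith g xs ys))

-- Chinese remainder theorem on lists: r + e(s - r) is r modulo m and s modulo p.
covers-* : ∀ {m p R S f} → Coprime m p → Covers m R f → Covers p S f →
  ∃ λ T → Covers (m * p) T f × length T ≡ length R * length S
covers-* {m} {p} {R} {S} {f} c R-covers S-covers with idempotent c
... | e , m∣e , p∣e-1 = cartesianProductWith glue R S , T-covers , length-cartesianProductWith glue R S
  where
  glue : ℤ → ℤ → ℤ
  glue r s = r ℤ.+ e ℤ.* (s ℤ.- r)
  T-covers : Covers (m * p) (cartesianProductWith glue R S) f
  T-covers x with R-covers x | S-covers x
  ... | r , r∈R , m∣ | s , s∈S , p∣ = glue r s , Mem.∈-cartesianProductWith⁺ glue r∈R s∈S ,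
    coprime-∣ c (subst (+ m ∣ℤ_) (lemma₁ (f x) r s e) (ℤ.∣m∣n⇒∣m-n m∣ (ℤ.∣m⇒∣m*n (s ℤ.- r) m∣e)))
                (subst (+ p ∣ℤ_) (lemma₂ (f x) r s e) (ℤ.∣m∣n⇒∣m-n p∣ (ℤ.∣m⇒∣m*n (s ℤ.- r) p∣e-1)))
    where
    lemma₁ : ∀ y r s e → (y ℤ.- r) ℤ.- e ℤ.* (s ℤ.- r) ≡ y ℤ.- (r ℤ.+ e ℤ.* (s ℤ.- r))
    lemma₁ = solve-∀
    lemma₂ : ∀ y r s e → (y ℤ.- s) ℤ.- (e ℤ.- 1ℤ) ℤ.* (s ℤ.- r) ≡ y ℤ.- (r ℤ.+ e ℤ.* (s ℤ.- r))
    lemma₂ = solve-∀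

prime-periodic* : ∀ {p} → Prime p → ∀ k f → k ℕ.< p → ConstDiff (suc k) 0ℤ f →
  ∀ x j → + p ∣ℤ f (x + j * p) ℤ.- f x
prime-periodic* {p} pr k f k<p h x zero = divides 0ℤ (trans (cong (λ n → f n ℤ.- f x) (ℕ.+-identityʳ x)) (ℤ.+-inverseʳ (f x)))
prime-periodic* {p} pr k f k<p h x (suc j) = ∣-chain {a = f (x + suc j * p)} {f (x + j * p)} {f x}
  (subst (λ n → + p ∣ℤ f n ℤ.- f (x + j * p)) (lemma x j p) (prime-periodic pr k f (x + j * p) k<p h))
  (prime-periodic* pr k f k<p h x j)
  where
  lemma : ∀ x j p → x + j * p + p ≡ x + suc j * p
  lemma = ℕ-Solver.solve-∀

-- Bernoulli's inequality (1 + 1/a)^j ≥ 1 + j/a with denominators cleared.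
bernoulli : ∀ a j → (a + j) * a ^ j ≤ a * suc a ^ j
bernoulli a zero = ℕ.≤-reflexive (cong (_* 1) (ℕ.+-identityʳ a))
bernoulli a (suc j) = begin
  (a + suc j) * (a * a ^ j)              ≤⟨ ℕ.m≤m+n _ (j * a ^ j) ⟩
  (a + suc j) * (a * a ^ j) + j * a ^ j  ≡⟨ lemma₁ a j (a ^ j) ⟩
  suc a * ((a + j) * a ^ j)              ≤⟨ ℕ.*-monoʳ-≤ (suc a) (bernoulli a j) ⟩
  suc a * (a * suc a ^ j)                ≡⟨ lemma₂ a (suc a ^ j) ⟩
  a * (suc a * suc a ^ j)                ∎
  where
  open ℕ.≤-Reasoning
  lemma₁ : ∀ a j b → (a + suc j) * (a * b) + j * b ≡ suc a * ((a + j) * b)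
  lemma₁ = ℕ-Solver.solve-∀
  lemma₂ : ∀ a b → suc a * (a * b) ≡ a * (suc a * b)
  lemma₂ = ℕ-Solver.solve-∀

-- Adjoining a prime multiplies the proportion of covering classes by at most a/(a + 1).
shrink : ∀ a j {t} r s m p → t ≡ r * s → r * suc a ^ j ≤ a ^ j * m → s * suc a + p ≤ suc a * p →
  t * suc a ^ suc j ≤ a ^ suc j * (m * p)
shrink a j r s m p refl R-small S-small = begin
  r * s * (suc a * suc a ^ j)     ≡⟨ lemma₁ r s (suc a) (suc a ^ j) ⟩
  r * suc a ^ j * (s * suc a)     ≤⟨ ℕ.*-mono-≤ R-small (ℕ.+-cancelʳ-≤ p _ _ (subst (s * suc a + p ≤_) (ℕ.+-comm p (a * p)) S-small)) ⟩
  a ^ j * m * (a * p)             ≡⟨ lemma₂ (a ^ j) m a p ⟩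
  a * a ^ j * (m * p)             ∎
  where
  open ℕ.≤-Reasoning
  lemma₁ : ∀ r s a b → r * s * (a * b) ≡ r * b * (s * a)
  lemma₁ = ℕ-Solver.solve-∀
  lemma₂ : ∀ b m a p → b * m * (a * p) ≡ a * b * (m * p)
  lemma₂ = ℕ-Solver.solve-∀

module _ (k : ℕ) {c f} (h : ConstDiff (2 + k) c f) (c≢0 : c ≢ 0ℤ) where

  private
    d = 2 + k
    h₀ : ConstDiff (suc d) 0ℤ f
    h₀ = constDiff-suc d {c} {f} h

  -- A prime divisor p of Δf(x₀) gives the collision f(x₀ + 1) ≡ f(x₀); moving the origin to x₀ puts
  -- it at 0 and 1. Taking p > d makes f periodic modulo p.
  prime-cover : ∀ Q → ∃₂ λ p R → Prime p × Q ℕ.< p × Covers p R f × length R * (2 * d) + p ≤ 2 * d * p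
  prime-cover Q = p , map +_ R , pr , ℕ.≤-<-trans (ℕ.m≤m⊔n Q d) Q⊔d<p , R-covers ,
      subst (λ l → l * (2 * d) + p ≤ 2 * d * p) (sym (List.length-map +_ R)) (few-residues pr d {φ} (s≤s z≤n) hφ collision)
    where
    found = large-prime-divisor k {c} {Δ f} h c≢0 (Q ℕ.⊔ d)
    p = proj₁ found
    x₀ = proj₁ (proj₂ found)
    pr = proj₁ (proj₂ (proj₂ found))
    Q⊔d<p = proj₁ (proj₂ (proj₂ (proj₂ found)))
    d<p = ℕ.≤-<-trans (ℕ.m≤n⊔m Q d) Q⊔d<p
    instance
      p≢0 : NonZero p
      p≢0 = prime⇒nonZero pr
    φ : ℕ → ℤ
    φ n = f (x₀ + n)
    hφ : ConstDiff (suc d) 0ℤ φ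
    hφ = constDiff-shift (suc d) x₀ {f = f} h₀
    R = Sorted.R (sorted-residues pr d {φ} (s≤s z≤n) hφ)
    collision : + p ∣ℤ φ 1 ℤ.- φ 0
    collision = subst₂ (λ a b → + p ∣ℤ f a ℤ.- f b) (ℕ.+-comm 1 x₀) (sym (ℕ.+-identityʳ x₀)) (proj₂ (proj₂ (proj₂ (proj₂ found))))
    R-covers : Covers p (map +_ R) f
    R-covers y = + residue pr d {φ} (s≤s z≤n) hφ n , Mem.∈-map⁺ +_ (residue∈R pr d {φ} (s≤s z≤n) hφ n (ℕ.m%n<n w p)) ,
        ∣-chain {a = f y} {f (x₀ + n)} (∣-chain {a = f y} {f (y + x₀ * p)} {f (x₀ + n)}
          (∣-flip {a = f (y + x₀ * p)} {f y} (prime-periodic* pr d f d<p h₀ y x₀))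
          (subst (λ i → + p ∣ℤ f i ℤ.- f (x₀ + n)) index (prime-periodic* pr d f d<p h₀ (x₀ + n) (w ℕ./ p))))
        (residue-cong pr d {φ} (s≤s z≤n) hφ n)
      where
      -- w stands for y - x₀ modulo p, written without subtraction since -x₀ ≡ x₀(p - 1).
      w = y + x₀ * ℕ.pred p
      n = w ℕ.% p
      index : x₀ + n + w ℕ./ p * p ≡ y + x₀ * p
      index = begin
        x₀ + n + w ℕ./ p * p          ≡⟨ ℕ.+-assoc x₀ n _ ⟩
        x₀ + (n + w ℕ./ p * p)        ≡⟨ cong (_+_ x₀) (ℕ.m≡m%n+[m/n]*n w p) ⟨
        x₀ + (y + x₀ * ℕ.pred p)      ≡⟨ lemma x₀ y (ℕ.pred p) ⟩
        y + x₀ * suc (ℕ.pred p)       ≡⟨ cong (λ n → y + x₀ * n) (ℕ.suc-pred p) ⟩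
        y + x₀ * p                    ∎
        where
        open ≡-Reasoning
        lemma : ∀ x y q → x + (y + x * q) ≡ y + x * suc q
        lemma = ℕ-Solver.solve-∀

  -- Each new prime exceeds the modulus reached so far, hence is coprime to it, and the proportion
  -- of classes shrinks by a/(a + 1) with a = 2d - 1.
  iterated-cover : ∀ a → suc a ≡ 2 * d → ∀ j → ∃₂ λ m R → 1 ≤ m × Covers m R f × length R * suc a ^ j ≤ a ^ j * m
  -- Modulus 1 has a single class, represented by 0.
  iterated-cover a eq zero = 1 , 0ℤ ∷ [] , s≤s z≤n , (λ x → 0ℤ , here refl , divides (f x ℤ.- 0ℤ) (sym (ℤ.*-identityʳ (f x ℤ.- 0ℤ)))) , ℕ.≤-refl
  iterated-cover a eq (suc j) = extend (iterated-cover a eq j)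
    where
    extend : (∃₂ λ m R → 1 ≤ m × Covers m R f × length R * suc a ^ j ≤ a ^ j * m) →
      ∃₂ λ m R → 1 ≤ m × Covers m R f × length R * suc a ^ suc j ≤ a ^ suc j * m
    extend (m , R , 1≤m , R-covers , R-small) = adjoin (prime-cover m)
      where
      adjoin : (∃₂ λ p S → Prime p × m ℕ.< p × Covers p S f × length S * (2 * d) + p ≤ 2 * d * p) →
        ∃₂ λ m R → 1 ≤ m × Covers m R f × length R * suc a ^ suc j ≤ a ^ suc j * m
      adjoin (p , S , pr , m<p , S-covers , S-small) =
        m * p , proj₁ glued , ℕ.*-mono-≤ 1≤m (ℕ.≤-trans 1≤m (ℕ.<⇒≤ m<p)) , proj₁ (proj₂ glued) ,
        shrink a j (length R) (length S) m p (proj₂ (proj₂ glued)) R-small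
          (subst (λ b → length S * b + p ≤ b * p) (sym eq) S-small)
        where
        glued : ∃ λ T → Covers (m * p) T f × length T ≡ length R * length S
        glued = covers-* {m} {p} {R} {S} {f} (Coprime.sym (prime⇒coprime pr {{ℕ.>-nonZero 1≤m}} m<p)) R-covers S-covers

  sparse-cover : ∀ E → ∃₂ λ m R → 1 ≤ m × Covers m R f × E * length R ≤ m
  sparse-cover E = thin (iterated-cover a refl j)
    where
    -- This is 2d - 1, written so that `suc a` and `2 * d` agree definitionally.
    a = suc k + suc (suc (k + 0))
    -- With this exponent Bernoulli gives (1 + 1/a)^j ≥ 1 + E, which is more than E.
    j = a * E
    E*a^j≤ : E * a ^ j ≤ suc a ^ j
    E*a^j≤ = ℕ.*-cancelˡ-≤ a (begin
      a * (E * a ^ j)      ≡⟨ ℕ.*-assoc a E (a ^ j) ⟨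
      a * E * a ^ j        ≤⟨ ℕ.*-monoˡ-≤ (a ^ j) (ℕ.m≤n+m (a * E) a) ⟩
      (a + j) * a ^ j      ≤⟨ bernoulli a j ⟩
      a * suc a ^ j        ∎)
      where open ℕ.≤-Reasoning
    thin : (∃₂ λ m R → 1 ≤ m × Covers m R f × length R * suc a ^ j ≤ a ^ j * m) →
      ∃₂ λ m R → 1 ≤ m × Covers m R f × E * length R ≤ m
    thin (m , R , 1≤m , R-covers , R-small) = m , R , 1≤m , R-covers ,
      ℕ.*-cancelˡ-≤ (a ^ j) {{ℕ.m^n≢0 a j}} (begin
        a ^ j * (E * length R)      ≡⟨ lemma (a ^ j) E (length R) ⟩
        length R * (E * a ^ j)      ≤⟨ ℕ.*-monoʳ-≤ (length R) E*a^j≤ ⟩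
        length R * suc a ^ j        ≤⟨ R-small ⟩
        a ^ j * m                   ∎)
      where
      open ℕ.≤-Reasoning
      lemma : ∀ b E r → b * (E * r) ≡ r * (E * b)
      lemma = ℕ-Solver.solve-∀

-- Counting

indicator : Bool → ℕ
indicator true  = 1
indicator false = 0

count-suc : ∀ V N → count V 0 (suc N) ≡ indicator (V (suc N)) + count V 0 N
count-suc V N with V (suc N)
... | true  = refl
... | false = refl

count-mono : ∀ U V → (∀ n → indicator (U n) ≤ indicator (V n)) → ∀ N → count U 0 N ≤ count V 0 N
count-mono U V U≤V zero = z≤n
count-mono U V U≤V (suc N) = subst₂ _≤_ (sym (count-suc U N)) (sym (count-suc V N)) (ℕ.+-mono-≤ (U≤V (suc N)) (count-mono U V U≤V N))

count-∨ : ∀ U V N → count (λ n → U n ∨ V n) 0 N ≤ count U 0 N + count V 0 N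
count-∨ U V zero = z≤n
count-∨ U V (suc N) = begin
  count (λ n → U n ∨ V n) 0 (suc N)
    ≡⟨ count-suc (λ n → U n ∨ V n) N ⟩
  indicator (U (suc N) ∨ V (suc N)) + count (λ n → U n ∨ V n) 0 N
    ≤⟨ ℕ.+-mono-≤ (indicator-∨ (U (suc N)) (V (suc N))) (count-∨ U V N) ⟩
  indicator (U (suc N)) + indicator (V (suc N)) + (count U 0 N + count V 0 N)
    ≡⟨ lemma (indicator (U (suc N))) (indicator (V (suc N))) (count U 0 N) (count V 0 N) ⟩
  indicator (U (suc N)) + count U 0 N + (indicator (V (suc N)) + count V 0 N)
    ≡⟨ cong₂ _+_ (sym (count-suc U N)) (sym (count-suc V N)) ⟩
  count U 0 (suc N) + count V 0 (suc N) ∎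
  where
  open ℕ.≤-Reasoning
  lemma : ∀ a b c d → a + b + (c + d) ≡ a + c + (b + d)
  lemma = ℕ-Solver.solve-∀
  indicator-∨ : ∀ a b → indicator (a ∨ b) ≤ indicator a + indicator b
  indicator-∨ true  b = s≤s z≤n
  indicator-∨ false b = ℕ.≤-refl

count-false : ∀ V N → (∀ n → n ≤ N → V n ≡ false) → count V 0 N ≡ 0
count-false V zero    h = refl
count-false V (suc N) h = trans (count-suc V N)
  (cong₂ (λ b c → indicator b + c) (h (suc N) ℕ.≤-refl) (count-false V N (λ n n≤N → h n (ℕ.m≤n⇒m≤1+n n≤N))))

inClass : ℕ → ℤ → ℕ → Bool
inClass m r n = does (+ m ℤ.∣? (+ n ℤ.- r))

inClass-∣ : ∀ {m r n} → inClass m r n ≡ true → + m ∣ℤ + n ℤ.- r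
inClass-∣ {m} {r} {n} = does-true (+ m ℤ.∣? (+ n ℤ.- r))
  where
  does-true : ∀ {P : Set} (P? : Dec P) → does P? ≡ true → P
  does-true (yes p) _ = p

∣⇒gap : ∀ {m l n} → l ℕ.< n → + m ∣ℤ + n ℤ.- + l → l + m ≤ n
∣⇒gap {m} {l} {n} l<n h with ℕ.∣⇒≤ {{ℕ.>-nonZero (ℕ.m<n⇒0<n∸m l<n)}}
  (subst (m ℕ.∣_) (cong ℤ.∣_∣ (trans (ℤ.m-n≡m⊖n n l) (ℤ.⊖-≥ (ℕ.<⇒≤ l<n)))) (ℤ.∣⇒∣ᵤ h))
... | m≤n∸l = subst (_≤ n) (ℕ.+-comm m l) (ℕ.m≤o∸n⇒m+n≤o m (ℕ.<⇒≤ l<n) m≤n∸l)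

-- The induction remembers the last element l of the class up to N. Elements of a class are at least
-- m apart, so a new element N + 1 satisfies l + m ≤ N + 1, which pays for the extra m on the left.
count-class-last : ∀ m r N → count (inClass m r) 0 N ≡ 0 ⊎
  (∃ λ l → l ≤ N × + m ∣ℤ + l ℤ.- r × suc (m * count (inClass m r) 0 N) ≤ l + m)
count-class-last m r zero = inj₁ refl
count-class-last m r (suc N) with inClass m r (suc N) in hit | count-class-last m r N
... | false | inj₁ c≡0 = inj₁ c≡0
... | false | inj₂ (l , l≤N , m∣ , bound) = inj₂ (l , ℕ.m≤n⇒m≤1+n l≤N , m∣ , bound)
... | true  | inj₁ c≡0 = inj₂ (suc N , ℕ.≤-refl , inClass-∣ {m} {r} {suc N} hit ,
        s≤s (subst (λ c → m * suc c ≤ N + m) (sym c≡0) (ℕ.≤-trans (ℕ.≤-reflexive (ℕ.*-identityʳ m)) (ℕ.m≤n+m m N))))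
... | true  | inj₂ (l , l≤N , m∣′ , bound) = inj₂ (suc N , ℕ.≤-refl , inClass-∣ {m} {r} {suc N} hit , (begin
    suc (m * suc c)           ≡⟨ cong suc (ℕ.*-suc m c) ⟩
    suc (m + m * c)           ≡⟨ ℕ.+-suc m (m * c) ⟨
    m + suc (m * c)           ≤⟨ ℕ.+-monoʳ-≤ m bound ⟩
    m + (l + m)               ≡⟨ ℕ.+-comm m (l + m) ⟩
    l + m + m                 ≤⟨ ℕ.+-monoˡ-≤ m (∣⇒gap (s≤s l≤N) (∣-chain {a = + suc N} {r} {+ l} (inClass-∣ {m} {r} {suc N} hit) (∣-flip {a = + l} {r} m∣′))) ⟩
    suc N + m                 ∎))
  where
  open ℕ.≤-Reasoning
  c = count (inClass m r) 0 N

count-class : ∀ m r N → m * count (inClass m r) 0 N ≤ N + m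
count-class m r N with count-class-last m r N
... | inj₁ c≡0 = ℕ.≤-trans (ℕ.≤-reflexive (trans (cong (m *_) c≡0) (ℕ.*-zeroʳ m))) z≤n
... | inj₂ (l , l≤N , _ , bound) = ℕ.≤-trans (ℕ.n≤1+n _) (ℕ.≤-trans bound (ℕ.+-monoˡ-≤ m l≤N))

inClasses : ℕ → List ℤ → ℕ → Bool
inClasses m R n = any (λ r → inClass m r n) R

inClasses-∈ : ∀ {m R r n} → r ∈ R → + m ∣ℤ + n ℤ.- r → inClasses m R n ≡ true
inClasses-∈ {m} {R = r ∷ R} {n = n} (here refl) h = cong (_∨ inClasses m R n) (dec-true (+ m ℤ.∣? (+ n ℤ.- r)) h)
inClasses-∈ {m} {R = s ∷ R} {n = n} (there r∈)  h = trans (cong (inClass m s n ∨_) (inClasses-∈ r∈ h)) (Bool.∨-zeroʳ (inClass m s n))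

count-classes : ∀ m R N → m * count (inClasses m R) 0 N ≤ length R * (N + m)
count-classes m [] N = ℕ.≤-trans (ℕ.≤-reflexive (trans (cong (m *_) (count-false (inClasses m []) N (λ _ _ → refl))) (ℕ.*-zeroʳ m))) z≤n
count-classes m (r ∷ R) N = begin
  m * count (inClasses m (r ∷ R)) 0 N                             ≤⟨ ℕ.*-monoʳ-≤ m (count-∨ (inClass m r) (inClasses m R) N) ⟩
  m * (count (inClass m r) 0 N + count (inClasses m R) 0 N)       ≡⟨ ℕ.*-distribˡ-+ m (count (inClass m r) 0 N) _ ⟩
  m * count (inClass m r) 0 N + m * count (inClasses m R) 0 N     ≤⟨ ℕ.+-mono-≤ (count-class m r N) (count-classes m R N) ⟩
  N + m + length R * (N + m)                                      ∎
  where open ℕ.≤-Reasoning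

-- The classes are only removed from m on, which absorbs the boundary term in
-- count-classes.
removed : ℕ → List ℤ → ℕ → Bool
removed m R n = does (m ℕ.≤? n) ∧ inClasses m R n

-- Valid for every N, not only in the limit, so that the bounds for infinitely many removed sets can
-- be added. For N < m the count is 0; from m on, N + m ≤ 2N, and the factor 2 in the hypothesis
-- absorbs this.
count-removed : ∀ {E m R} → 1 ≤ m → (2 * E) * length R ≤ m → ∀ N → E * count (removed m R) 0 N ≤ N
count-removed {E} {m} {R} 1≤m R-small N with m ℕ.≤? N
... | no  m≰N = ℕ.≤-trans (ℕ.≤-reflexive (trans (cong (E *_) (count-false (removed m R) N
                  (λ n n≤N → cong (_∧ inClasses m R n) (dec-false (m ℕ.≤? n) (λ m≤n → m≰N (ℕ.≤-trans m≤n n≤N)))))) (ℕ.*-zeroʳ E))) z≤n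
... | yes m≤N = ℕ.*-cancelˡ-≤ (2 * m) {{ℕ.>-nonZero (ℕ.≤-trans 1≤m (ℕ.m≤m+n m (m + 0)))}} (begin
  2 * m * (E * c)               ≤⟨ ℕ.*-monoʳ-≤ (2 * m) (ℕ.*-monoʳ-≤ E c≤c′) ⟩
  2 * m * (E * c′)              ≡⟨ lemma₁ m E c′ ⟩
  2 * E * (m * c′)              ≤⟨ ℕ.*-monoʳ-≤ (2 * E) (count-classes m R N) ⟩
  2 * E * (length R * (N + m))  ≡⟨ ℕ.*-assoc (2 * E) (length R) (N + m) ⟨
  2 * E * length R * (N + m)    ≤⟨ ℕ.*-mono-≤ R-small (ℕ.+-monoʳ-≤ N m≤N) ⟩
  m * (N + N)                   ≡⟨ lemma₂ m N ⟩
  2 * m * N                     ∎)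
  where
  open ℕ.≤-Reasoning
  c = count (removed m R) 0 N
  c′ = count (inClasses m R) 0 N
  indicator-∧ : ∀ a b → indicator (a ∧ b) ≤ indicator b
  indicator-∧ true  b = ℕ.≤-refl
  indicator-∧ false b = z≤n
  c≤c′ : c ≤ c′
  c≤c′ = count-mono (removed m R) (inClasses m R) (λ n → indicator-∧ (does (m ℕ.≤? n)) (inClasses m R n)) N
  lemma₁ : ∀ m E c → 2 * m * (E * c) ≡ 2 * E * (m * c)
  lemma₁ = ℕ-Solver.solve-∀
  lemma₂ : ∀ m N → m * (N + N) ≡ 2 * m * N
  lemma₂ = ℕ-Solver.solve-∀

-- Unions of infinitely many small sets

sumBelow : ℕ → (ℕ → ℕ) → ℕ
sumBelow zero    h = 0
sumBelow (suc j) h = h j + sumBelow j h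

sumBelow-+ : ∀ j h h′ → sumBelow j (λ i → h i + h′ i) ≡ sumBelow j h + sumBelow j h′
sumBelow-+ zero    h h′ = refl
sumBelow-+ (suc j) h h′ = trans (cong (_+_ (h j + h′ j)) (sumBelow-+ j h h′)) (lemma (h j) (h′ j) (sumBelow j h) (sumBelow j h′))
  where
  lemma : ∀ a b c d → a + b + (c + d) ≡ a + c + (b + d)
  lemma = ℕ-Solver.solve-∀

sumBelow-cong : ∀ j {h h′} → (∀ i → h i ≡ h′ i) → sumBelow j h ≡ sumBelow j h′
sumBelow-cong zero    eq = refl
sumBelow-cong (suc j) eq = cong₂ _+_ (eq j) (sumBelow-cong j eq)

sumBelow-mono : ∀ {i j} h → i ≤ j → sumBelow i h ≤ sumBelow j h
sumBelow-mono {j = zero} h z≤n = z≤n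
sumBelow-mono {j = suc j} h i≤1+j with ℕ.m≤n⇒m<n∨m≡n i≤1+j
... | inj₁ i<1+j = ℕ.≤-trans (sumBelow-mono h (ℕ.≤-pred i<1+j)) (ℕ.m≤n+m _ (h j))
... | inj₂ refl  = ℕ.≤-refl

geometric : ∀ K N (c : ℕ → ℕ) → (∀ j → K * 2 ^ suc j * c j ≤ N) → ∀ J → K * sumBelow J c ≤ N
geometric K N c small J = ℕ.*-cancelˡ-≤ (2 ^ J) {{ℕ.m^n≢0 2 J}} (begin
  2 ^ J * (K * sumBelow J c)        ≤⟨ ℕ.m≤m+n _ N ⟩
  2 ^ J * (K * sumBelow J c) + N    ≤⟨ partial J ⟩
  2 ^ J * N                         ∎)
  where
  open ℕ.≤-Reasoning
  -- The induction needs the exact partial sum 1 - 2^(-J) of the geometric series, here multiplied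
  -- by 2^J · N.
  partial : ∀ J → 2 ^ J * (K * sumBelow J c) + N ≤ 2 ^ J * N
  partial zero = ℕ.≤-reflexive (trans (cong (λ n → 1 * n + N) (ℕ.*-zeroʳ K)) (sym (ℕ.*-identityˡ N)))
  partial (suc J) = begin
    2 * 2 ^ J * (K * (c J + sumBelow J c)) + N                   ≡⟨ lemma₁ (2 ^ J) K (c J) (sumBelow J c) N ⟩
    2 * (2 ^ J * (K * sumBelow J c)) + (K * (2 * 2 ^ J) * c J + N) ≤⟨ ℕ.+-monoʳ-≤ (2 * (2 ^ J * (K * sumBelow J c))) (ℕ.+-monoˡ-≤ N (small J)) ⟩
    2 * (2 ^ J * (K * sumBelow J c)) + (N + N)                   ≡⟨ lemma₂ (2 ^ J * (K * sumBelow J c)) N ⟩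
    2 * (2 ^ J * (K * sumBelow J c) + N)                         ≤⟨ ℕ.*-monoʳ-≤ 2 (partial J) ⟩
    2 * (2 ^ J * N)                                              ≡⟨ ℕ.*-assoc 2 (2 ^ J) N ⟨
    2 * 2 ^ J * N                                                ∎
    where
    lemma₁ : ∀ b K c s N → 2 * b * (K * (c + s)) + N ≡ 2 * (b * (K * s)) + (K * (2 * b) * c + N)
    lemma₁ = ℕ-Solver.solve-∀
    lemma₂ : ∀ a N → 2 * a + (N + N) ≡ 2 * (a + N)
    lemma₂ = ℕ-Solver.solve-∀

anyBelow : ℕ → (ℕ → Bool) → Bool
anyBelow zero    W = false
anyBelow (suc j) W = W j ∨ anyBelow j W

anyBelow-true : ∀ {i j} W → i ℕ.< j → W i ≡ true → anyBelow j W ≡ true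
anyBelow-true {i} {suc j} W i<1+j Wi with ℕ.m≤n⇒m<n∨m≡n (ℕ.≤-pred i<1+j)
... | inj₁ i<j  = trans (cong (W j ∨_) (anyBelow-true W i<j Wi)) (Bool.∨-zeroʳ (W j))
... | inj₂ refl = cong (_∨ anyBelow i W) Wi

-- Only the sets `W j` with j < n are tested at n, so that membership is decidable; each `W j` is
-- still removed from j + 1 on.
complement : (ℕ → ℕ → Bool) → ℕ → Bool
complement W n = not (anyBelow n (λ j → W j n))

-- Each positive n up to N lies in the complement or in some `W j` with j < n ≤ J.
count-complement : ∀ W J N → N ≤ J → N ≤ count (complement W) 0 N + sumBelow J (λ j → count (W j) 0 N)
count-complement W J zero    _     = z≤n
count-complement W J (suc N) 1+N≤J = begin
  1 + N
    ≤⟨ ℕ.+-mono-≤ (one (suc N) 1+N≤J) (count-complement W J N (ℕ.<⇒≤ 1+N≤J)) ⟩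
  indicator (complement W (suc N)) + sumBelow J (λ j → indicator (W j (suc N))) + (count (complement W) 0 N + sumBelow J (λ j → count (W j) 0 N))
    ≡⟨ lemma (indicator (complement W (suc N))) _ (count (complement W) 0 N) _ ⟩
  (indicator (complement W (suc N)) + count (complement W) 0 N) + (sumBelow J (λ j → indicator (W j (suc N))) + sumBelow J (λ j → count (W j) 0 N))
    ≡⟨ cong₂ _+_ (sym (count-suc (complement W) N)) (sym (trans (sumBelow-cong J (λ j → count-suc (W j) N)) (sumBelow-+ J _ _))) ⟩
  count (complement W) 0 (suc N) + sumBelow J (λ j → count (W j) 0 (suc N)) ∎
  where
  open ℕ.≤-Reasoning
  lemma : ∀ a b c d → a + b + (c + d) ≡ a + c + (b + d)
  lemma = ℕ-Solver.solve-∀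
  union : ∀ i V → 1 ≤ indicator (not (anyBelow i V)) + sumBelow i (λ j → indicator (V j))
  union zero    V = ℕ.≤-refl
  union (suc i) V with V i
  ... | true  = s≤s z≤n
  ... | false = union i V
  one : ∀ n → n ≤ J → 1 ≤ indicator (complement W n) + sumBelow J (λ j → indicator (W j n))
  one n n≤J = ℕ.≤-trans (union n (λ j → W j n)) (ℕ.+-monoʳ-≤ (indicator (complement W n)) (sumBelow-mono (λ j → indicator (W j n)) n≤J))

count-complement-large : ∀ K W → (∀ j N → K * 2 ^ suc j * count (W j) 0 N ≤ N) →
  ∀ N → K * N ≤ K * count (complement W) 0 N + N
count-complement-large K W small N = begin
  K * N                                                                    ≤⟨ ℕ.*-monoʳ-≤ K (count-complement W N N ℕ.≤-refl) ⟩
  K * (count (complement W) 0 N + sumBelow N (λ j → count (W j) 0 N))      ≡⟨ ℕ.*-distribˡ-+ K (count (complement W) 0 N) _ ⟩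
  K * count (complement W) 0 N + K * sumBelow N (λ j → count (W j) 0 N)    
    ≤⟨ ℕ.+-monoʳ-≤ (K * count (complement W) 0 N) (geometric K N (λ j → count (W j) 0 N) (λ j → small j N) N) ⟩
  K * count (complement W) 0 N + N                                         ∎
  where open ℕ.≤-Reasoning

-- Rational polynomials

private
  interchangeℚ : ∀ a b c d → (a ℚ.+ b) ℚ.- (c ℚ.+ d) ≡ (a ℚ.- c) ℚ.+ (b ℚ.- d)
  interchangeℚ = solve 4 (λ a b c d → (a :+ b) :- (c :+ d) := (a :- c) :+ (b :- d)) refl
    where open ℚ-Solver.+-*-Solver

module Δℚ = Difference ℚ._+_ ℚ._-_ interchangeℚ

toℚᵘ-toℚ : ∀ z → ℚ.toℚᵘ (toℚ z) ≃ mkℚᵘ z 0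
toℚᵘ-toℚ z = ℚ.toℚᵘ-fromℚᵘ (mkℚᵘ z 0)

toℚ-injective : ∀ {a b} → toℚ a ≡ toℚ b → a ≡ b
toℚ-injective {a} {b} eq with ℚᵘ.≃-trans (ℚᵘ.≃-sym (toℚᵘ-toℚ a)) (ℚᵘ.≃-trans (ℚᵘ.≃-reflexive (cong ℚ.toℚᵘ eq)) (toℚᵘ-toℚ b))
... | *≡* a*1≡b*1 = trans (sym (ℤ.*-identityʳ a)) (trans a*1≡b*1 (ℤ.*-identityʳ b))

toℚ-+ : ∀ a b → toℚ (a ℤ.+ b) ≡ toℚ a ℚ.+ toℚ b
toℚ-+ a b = ℚ.toℚᵘ-injective (begin-equality
  ℚ.toℚᵘ (toℚ (a ℤ.+ b))                    ≃⟨ toℚᵘ-toℚ (a ℤ.+ b) ⟩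
  mkℚᵘ (a ℤ.+ b) 0                          ≃⟨ *≡* (cong (ℤ._* 1ℤ) (sym (cong₂ ℤ._+_ (ℤ.*-identityʳ a) (ℤ.*-identityʳ b)))) ⟩
  mkℚᵘ a 0 ℚᵘ.+ mkℚᵘ b 0                    ≃⟨ ℚᵘ.+-cong (toℚᵘ-toℚ a) (toℚᵘ-toℚ b) ⟨
  ℚ.toℚᵘ (toℚ a) ℚᵘ.+ ℚ.toℚᵘ (toℚ b)        ≃⟨ ℚ.toℚᵘ-homo-+ (toℚ a) (toℚ b) ⟨
  ℚ.toℚᵘ (toℚ a ℚ.+ toℚ b)                  ∎)
  where open ℚᵘ.≤-Reasoning

toℚ-neg : ∀ a → toℚ (ℤ.- a) ≡ ℚ.- toℚ a
toℚ-neg a = ℚ.toℚᵘ-injective (begin-equality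
  ℚ.toℚᵘ (toℚ (ℤ.- a))                      ≃⟨ toℚᵘ-toℚ (ℤ.- a) ⟩
  ℚᵘ.- mkℚᵘ a 0                             ≃⟨ ℚᵘ.-‿cong (toℚᵘ-toℚ a) ⟨
  ℚᵘ.- ℚ.toℚᵘ (toℚ a)                       ≃⟨ ℚ.toℚᵘ-homo‿- (toℚ a) ⟨
  ℚ.toℚᵘ (ℚ.- toℚ a)                        ∎)
  where open ℚᵘ.≤-Reasoning

toℚ-sub : ∀ a b → toℚ (a ℤ.- b) ≡ toℚ a ℚ.- toℚ b
toℚ-sub a b = trans (toℚ-+ a (ℤ.- b)) (cong (ℚ._+_ (toℚ a)) (toℚ-neg b))

toℚ-suc : ∀ n → toℚ (+ suc n) ≡ 1ℚ ℚ.+ toℚ (+ n)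
toℚ-suc n = toℚ-+ 1ℤ (+ n)

toℚ-suc-cancel : ∀ n c → toℚ (+ suc n) ℚ.* c ≡ 0ℚ → c ≡ 0ℚ
toℚ-suc-cancel n c eq = begin
  c                             ≡⟨ ℚ.*-identityˡ c ⟨
  1ℚ ℚ.* c                      ≡⟨ cong (ℚ._* c) (ℚ.*-inverseˡ p) ⟨
  (ℚ.1/ p) ℚ.* p ℚ.* c          ≡⟨ ℚ.*-assoc (ℚ.1/ p) p c ⟩
  (ℚ.1/ p) ℚ.* (p ℚ.* c)        ≡⟨ cong ((ℚ.1/ p) ℚ.*_) eq ⟩
  (ℚ.1/ p) ℚ.* 0ℚ               ≡⟨ ℚ.*-zeroʳ (ℚ.1/ p) ⟩
  0ℚ                            ∎
  where
  open ≡-Reasoning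
  p = toℚ (+ suc n)
  instance
    p≢0 : ℚ.NonZero p
    p≢0 = ℚ.pos⇒nonZero p {{ℚ.normalize-pos (suc n) 1}}

-- Since Δ(n f(n)) = n Δf(n) + f(n + 1), the factor of c grows by one with each k, starting from 1.
-- Iterated along a coefficient list, this produces d! times the leading coefficient.
constDiff-x* : ∀ k {c f} → Δℚ.ConstDiff k c f →
  Δℚ.ConstDiff (suc k) (toℚ (+ suc k) ℚ.* c) (λ n → toℚ (+ n) ℚ.* f n)
constDiff-x* zero {c} {f} h n = trans (cong₂ (λ a b → toℚ (+ suc n) ℚ.* a ℚ.- toℚ (+ n) ℚ.* b) (h (suc n)) (h n))
  (trans (cong (λ x → x ℚ.* c ℚ.- toℚ (+ n) ℚ.* c) (toℚ-suc n)) (lemma (toℚ (+ n)) c))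
  where
  open ℚ-Solver.+-*-Solver
  lemma : ∀ x c → (1ℚ ℚ.+ x) ℚ.* c ℚ.- x ℚ.* c ≡ 1ℚ ℚ.* c
  lemma = solve 2 (λ x c → (con 1ℚ :+ x) :* c :- x :* c := con 1ℚ :* c) refl
constDiff-x* (suc k) {c} {f} h =
  subst (λ e → Δℚ.ConstDiff (suc k) e (Δℚ.Δ (λ n → toℚ (+ n) ℚ.* f n))) (sym total)
    (Δℚ.constDiff-cong (suc k) leibniz
      (Δℚ.constDiff-+ (suc k) {f = λ n → toℚ (+ n) ℚ.* Δℚ.Δ f n} {g = λ n → f (suc n)}
        (constDiff-x* k {f = Δℚ.Δ f} h) (Δℚ.constDiff-shift (suc k) 1 {f = f} h)))
  where
  open ℚ-Solver.+-*-Solver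
  lemma₁ : ∀ x y z → x ℚ.* (y ℚ.- z) ℚ.+ y ≡ (1ℚ ℚ.+ x) ℚ.* y ℚ.- x ℚ.* z
  lemma₁ = solve 3 (λ x y z → x :* (y :- z) :+ y := (con 1ℚ :+ x) :* y :- x :* z) refl
  lemma₂ : ∀ x c → (1ℚ ℚ.+ x) ℚ.* c ≡ x ℚ.* c ℚ.+ c
  lemma₂ = solve 2 (λ x c → (con 1ℚ :+ x) :* c := x :* c :+ c) refl
  total : toℚ (+ suc (suc k)) ℚ.* c ≡ toℚ (+ suc k) ℚ.* c ℚ.+ c
  total = trans (cong (ℚ._* c) (toℚ-suc (suc k))) (lemma₂ (toℚ (+ suc k)) c)
  leibniz : ∀ n → toℚ (+ n) ℚ.* Δℚ.Δ f n ℚ.+ f (suc n) ≡ Δℚ.Δ (λ n → toℚ (+ n) ℚ.* f n) n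
  leibniz n = trans (lemma₁ (toℚ (+ n)) (f (suc n)) (f n))
    (cong (λ x → x ℚ.* f (suc n) ℚ.- toℚ (+ n) ℚ.* f n) (sym (toℚ-suc n)))

values : Poly → ℕ → ℚ
values P n = eval P (toℚ (+ n))

Zero : Poly → Set
Zero P = (∀ i → coeff P i ≡ 0ℚ) × (∀ n → values P n ≡ 0ℚ)

-- The constant c is d! times the leading coefficient. The condition on coefficients links this
-- notion to `DegreeAtLeast2`.
HasDegree : ℕ → Poly → Set
HasDegree d P = (∀ i → d ℕ.< i → coeff P i ≡ 0ℚ) × (∃ λ c → c ≢ 0ℚ × Δℚ.ConstDiff d c (values P))

hasDegree-∷ : ∀ a d P → HasDegree d P → HasDegree (suc d) (a ∷ P)
hasDegree-∷ a d P (above , c , c≢0 , h) = above′ , c′ , (λ c′≡0 → c≢0 (toℚ-suc-cancel d c c′≡0)) ,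
    Δℚ.constDiff-cong d {c′} {Δℚ.Δ xP} {Δℚ.Δ (values (a ∷ P))} (λ n → lemma a (xP (suc n)) (xP n))
      (constDiff-x* d {c} {values P} h)
  where
  open ℚ-Solver.+-*-Solver
  c′ : ℚ
  c′ = toℚ (+ suc d) ℚ.* c
  xP : ℕ → ℚ
  xP n = toℚ (+ n) ℚ.* values P n
  above′ : ∀ i → suc d ℕ.< i → coeff (a ∷ P) i ≡ 0ℚ
  above′ (suc i) 1+d<1+i = above i (ℕ.≤-pred 1+d<1+i)
  lemma : ∀ a x y → x ℚ.- y ≡ (a ℚ.+ x) ℚ.- (a ℚ.+ y)
  lemma = solve 3 (λ a x y → x :- y := (a :+ x) :- (a :+ y)) refl

zero-∷ : ∀ a P → Zero P → Zero (a ∷ P) ⊎ HasDegree 0 (a ∷ P)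
zero-∷ a P (P≡0 , values≡0) = helper (a ℚ.≟ 0ℚ)
  where
  constant : ∀ n → values (a ∷ P) n ≡ a
  constant n = trans (cong (λ v → a ℚ.+ toℚ (+ n) ℚ.* v) (values≡0 n))
    (trans (cong (ℚ._+_ a) (ℚ.*-zeroʳ (toℚ (+ n)))) (ℚ.+-identityʳ a))
  helper : Dec (a ≡ 0ℚ) → Zero (a ∷ P) ⊎ HasDegree 0 (a ∷ P)
  helper (yes a≡0) = inj₁ ((λ { zero → a≡0 ; (suc i) → P≡0 i }) , λ n → trans (constant n) a≡0)
  helper (no  a≢0) = inj₂ ((λ { (suc i) _ → P≡0 i }) , a , a≢0 , constant)

-- The list may end in zeros, so its length does not give the degree; the recursion starts counting
-- at the last nonzero coefficient, found by decidable equality in ℚ.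
zero-or-degree : ∀ P → Zero P ⊎ (∃ λ d → HasDegree d P)
zero-or-degree []      = inj₁ ((λ _ → refl) , (λ _ → refl))
zero-or-degree (a ∷ P) = [ (λ z → [ inj₁ , (λ h → inj₂ (0 , h)) ]′ (zero-∷ a P z))
                         , (λ { (d , h) → inj₂ (suc d , hasDegree-∷ a d P h) }) ]′ (zero-or-degree P)

constDiff-integral : ∀ d {c f} (g : ℕ → ℤ) → (∀ n → f n ≡ toℚ (g n)) → Δℚ.ConstDiff d c f →
  ∃ λ c′ → toℚ c′ ≡ c × ConstDiff d c′ g
constDiff-integral zero    g f≗g h = g 0 , trans (sym (f≗g 0)) (h 0) ,
  λ n → toℚ-injective (trans (sym (f≗g n)) (trans (h n) (trans (sym (h 0)) (f≗g 0))))
constDiff-integral (suc d) g f≗g h = constDiff-integral d (Δ g)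
  (λ n → trans (cong₂ ℚ._-_ (f≗g (suc n)) (f≗g n)) (sym (toℚ-sub (g (suc n)) (g n)))) h

hasDegree-integral : ∀ d {P} (g : ℕ → ℤ) → (∀ n → values P n ≡ toℚ (g n)) → HasDegree d P →
  ∃ λ c → c ≢ 0ℤ × ConstDiff d c g
hasDegree-integral d {P} g P≗g (_ , c , c≢0 , h) = proj₁ integral ,
    (λ c′≡0 → c≢0 (trans (sym (proj₁ (proj₂ integral))) (cong toℚ c′≡0))) , proj₂ (proj₂ integral)
  where
  integral : ∃ λ c′ → toℚ c′ ≡ c × ConstDiff d c′ g
  integral = constDiff-integral d {c} {values P} g P≗g h

degree≥2 : ∀ P → DegreeAtLeast2 P → ∃ λ k → HasDegree (2 + k) P
degree≥2 P (i , 2≤i , Pᵢ≢0) = helper (zero-or-degree P)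
  where
  helper : Zero P ⊎ (∃ λ d → HasDegree d P) → ∃ λ k → HasDegree (2 + k) P
  helper (inj₁ (P≡0 , _))                     = contradiction (P≡0 i) Pᵢ≢0
  helper (inj₂ (zero        , above , _))     = contradiction (above i (ℕ.≤-trans (s≤s z≤n) 2≤i)) Pᵢ≢0
  helper (inj₂ (suc zero    , above , _))     = contradiction (above i 2≤i) Pᵢ≢0
  helper (inj₂ (suc (suc k) , degree))        = k , degree

linear : ∀ t → ConstDiff 2 0ℤ (λ n → + n ℤ.+ t)
linear t n = lemma (+ n) t
  where
  lemma : ∀ n t → ((1ℤ ℤ.+ (1ℤ ℤ.+ n) ℤ.+ t) ℤ.- (1ℤ ℤ.+ n ℤ.+ t)) ℤ.- ((1ℤ ℤ.+ n ℤ.+ t) ℤ.- (n ℤ.+ t)) ≡ 0ℤ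
  lemma = solve-∀

-- The second and higher differences of n + t are 0. Hence f has the same leading difference as P
-- for every t, which is where degree at least 2 enters.
constDiff-+linear : ∀ k {c g} t → ConstDiff (2 + k) c g → ConstDiff (2 + k) c (λ n → g n ℤ.+ (+ n ℤ.+ t))
constDiff-+linear k {c} {g} t h = subst (λ c → ConstDiff (2 + k) c (λ n → g n ℤ.+ (+ n ℤ.+ t))) (ℤ.+-identityʳ c)
  (constDiff-+ (2 + k) {c} {0ℤ} {g} {λ n → + n ℤ.+ t} h (constDiff-0 k {Δ (Δ (λ n → + n ℤ.+ t))} (linear t)))

-- Rational form of the density bound

toℚᵘ-/ : ∀ z k → ℚ.toℚᵘ (z ℚ./ suc k) ≃ mkℚᵘ z k
toℚᵘ-/ z k = ℚ.toℚᵘ-fromℚᵘ (mkℚᵘ z k)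

-- With d + 1 the denominator of ε, ε ≥ 1/(d + 1) > 1/(d + 2), so k = d works.
1-ε<[1+k]/[2+k] : ∀ ε → 0ℚ < ε → ∃ λ k → 1ℚ - ε < (+ suc k ℚ./ (2 + k))
1-ε<[1+k]/[2+k] (mkℚ (+ zero) d c)   (ℚ.*<* (+<+ ()))
1-ε<[1+k]/[2+k] (mkℚ -[1+ n ] d c)   (ℚ.*<* ())
1-ε<[1+k]/[2+k] ε@(mkℚ (+ suc n) d c) 0<ε = d , ℚ.toℚᵘ-cancel-< (begin-strict
  ℚ.toℚᵘ (1ℚ ℚ.- ε)                        ≃⟨ ℚ.toℚᵘ-homo-+ 1ℚ (ℚ.- ε) ⟩
  mkℚᵘ 1ℤ 0 ℚᵘ.- mkℚᵘ (+ suc n) d          <⟨ *<* below ⟩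
  mkℚᵘ (+ suc d) (suc d)                   ≃⟨ toℚᵘ-/ (+ suc d) (suc d) ⟨
  ℚ.toℚᵘ (+ suc d ℚ./ (2 + d))             ∎)
  where
  open ℚᵘ.≤-Reasoning
  D = + suc d
  lemma : ∀ D N → D ℤ.* (1ℤ ℤ.* D) ≡ (1ℤ ℤ.* D ℤ.+ ℤ.- (1ℤ ℤ.+ N) ℤ.* 1ℤ) ℤ.* (1ℤ ℤ.+ D) ℤ.+ (1ℤ ℤ.+ (N ℤ.+ N ℤ.* D))
  lemma = solve-∀
  below : (1ℤ ℤ.* D ℤ.+ ℤ.- + suc n ℤ.* 1ℤ) ℤ.* + (2 + d) ℤ.< D ℤ.* + (1 * suc d)
  below = subst₂ ℤ._<_ (ℤ.+-identityʳ _)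
    (trans (cong (λ z → (1ℤ ℤ.* D ℤ.+ ℤ.- + suc n ℤ.* 1ℤ) ℤ.* + (2 + d) ℤ.+ (1ℤ ℤ.+ (+ n ℤ.+ z))) (ℤ.pos-* n (suc d)))
      (trans (sym (lemma D (+ n))) (cong (D ℤ.*_) (sym (ℤ.pos-* 1 (suc d))))))
    (ℤ.+-monoʳ-< ((1ℤ ℤ.* D ℤ.+ ℤ.- + suc n ℤ.* 1ℤ) ℤ.* + (2 + d)) (+<+ (s≤s (z≤n {n + n * suc d}))))

fraction-bound : ∀ k N c → (2 + k) * N ≤ (2 + k) * c + N → (+ suc k ℚ./ (2 + k)) ℚ.* toℚ (+ N) ℚ.≤ toℚ (+ c)
fraction-bound k N c h = ℚ.toℚᵘ-cancel-≤ (begin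
  ℚ.toℚᵘ ((+ suc k ℚ./ (2 + k)) ℚ.* toℚ (+ N))               ≃⟨ ℚ.toℚᵘ-homo-* (+ suc k ℚ./ (2 + k)) (toℚ (+ N)) ⟩
  ℚ.toℚᵘ (+ suc k ℚ./ (2 + k)) ℚᵘ.* ℚ.toℚᵘ (toℚ (+ N))       ≃⟨ ℚᵘ.*-cong (toℚᵘ-/ (+ suc k) (suc k)) (toℚᵘ-toℚ (+ N)) ⟩
  mkℚᵘ (+ suc k) (suc k) ℚᵘ.* mkℚᵘ (+ N) 0                   ≤⟨ *≤* (subst₂ ℤ._≤_ left right (+≤+ h′)) ⟩
  mkℚᵘ (+ c) 0                                               ≃⟨ toℚᵘ-toℚ (+ c) ⟨
  ℚ.toℚᵘ (toℚ (+ c))                                         ∎)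
  where
  open ℚᵘ.≤-Reasoning
  h′ : suc k * N ≤ c * ((2 + k) * 1)
  h′ = ℕ.+-cancelʳ-≤ N _ _ (subst₂ _≤_ (ℕ.+-comm N (suc k * N)) (cong (_+ N) (lemma k c)) h)
    where
    lemma : ∀ k c → (2 + k) * c ≡ c * ((2 + k) * 1)
    lemma = ℕ-Solver.solve-∀
  left : + (suc k * N) ≡ + suc k ℤ.* + N ℤ.* 1ℤ
  left = trans (ℤ.pos-* (suc k) N) (sym (ℤ.*-identityʳ (+ suc k ℤ.* + N)))
  right : + (c * ((2 + k) * 1)) ≡ + c ℤ.* + ((2 + k) * 1)
  right = ℤ.pos-* c ((2 + k) * 1)

-- Enumeration of the shifts and congruent pairs in infinite sets

next : ℤ → ℤ
next (+ n)    = -[1+ n ]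
next -[1+ n ] = + suc n

-- The order is 0, -1, 1, -2, 2, and so on; it indexes the removed sets by the shifts t.
enum : ℕ → ℤ
enum zero    = + 0
enum (suc i) = next (enum i)

enum-surjective : ∀ t → ∃ λ j → enum j ≡ t
enum-surjective (+ n)    = nonNeg n
  where
  nonNeg : ∀ n → ∃ λ j → enum j ≡ + n
  nonNeg zero    = 0 , refl
  nonNeg (suc n) with nonNeg n
  ... | j , eq = 2 + j , cong (next ∘ next) eq
enum-surjective -[1+ n ] with enum-surjective (+ n)
... | j , eq = suc j , cong next eq

%-≡⇒∣ : ∀ m .{{_ : NonZero m}} a b → a ℕ.% m ≡ b ℕ.% m → + m ∣ℤ + a ℤ.- + b
%-≡⇒∣ m a b eq = divides (+ (a ℕ./ m) ℤ.- + (b ℕ./ m)) (begin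
  + a ℤ.- + b
    ≡⟨ cong₂ (λ x y → x ℤ.- y) (split a) (split b) ⟩
  (+ (a ℕ.% m) ℤ.+ + (a ℕ./ m) ℤ.* + m) ℤ.- (+ (b ℕ.% m) ℤ.+ + (b ℕ./ m) ℤ.* + m)
    ≡⟨ cong (λ r → (+ r ℤ.+ + (a ℕ./ m) ℤ.* + m) ℤ.- (+ (b ℕ.% m) ℤ.+ + (b ℕ./ m) ℤ.* + m)) eq ⟩
  (+ (b ℕ.% m) ℤ.+ + (a ℕ./ m) ℤ.* + m) ℤ.- (+ (b ℕ.% m) ℤ.+ + (b ℕ./ m) ℤ.* + m)
    ≡⟨ lemma (+ (b ℕ.% m)) (+ (a ℕ./ m)) (+ (b ℕ./ m)) (+ m) ⟩
  (+ (a ℕ./ m) ℤ.- + (b ℕ./ m)) ℤ.* + m ∎)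
  where
  open ≡-Reasoning
  split : ∀ a → + a ≡ + (a ℕ.% m) ℤ.+ + (a ℕ./ m) ℤ.* + m
  split a = trans (cong +_ (ℕ.m≡m%n+[m/n]*n a m)) (trans (ℤ.pos-+ (a ℕ.% m) _) (cong (ℤ._+_ (+ (a ℕ.% m))) (ℤ.pos-* (a ℕ./ m) m)))
  lemma : ∀ r x y m → (r ℤ.+ x ℤ.* m) ℤ.- (r ℤ.+ y ℤ.* m) ≡ (x ℤ.- y) ℤ.* m
  lemma = solve-∀

module _ {B : ℕ → Set} (B∞ : Infinite B) (Θ : ℕ → ℕ) where

  private
    b : ℕ → ℕ
    b zero    = proj₁ (B∞ 1)
    b (suc i) = proj₁ (B∞ (suc (b i) + Θ (b i)))

    b∈B : ∀ i → B (b i)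
    b∈B zero    = proj₂ (proj₂ (B∞ 1))
    b∈B (suc i) = proj₂ (proj₂ (B∞ (suc (b i) + Θ (b i))))

    gap : ∀ i → suc (b i) + Θ (b i) ≤ b (suc i)
    gap i = proj₁ (proj₂ (B∞ (suc (b i) + Θ (b i))))

    gaps : ∀ {i j} → i ℕ.< j → suc (b i) + Θ (b i) ≤ b j
    gaps {i} {suc j} i<1+j with ℕ.m≤n⇒m<n∨m≡n (ℕ.≤-pred i<1+j)
    ... | inj₁ i<j  = ℕ.≤-trans (gaps i<j) (ℕ.≤-trans (ℕ.m≤n+m (b j) 1) (ℕ.≤-trans (ℕ.m≤m+n (suc (b j)) (Θ (b j))) (gap j)))
    ... | inj₂ refl = gap i

    b≥1 : ∀ i → 1 ≤ b i
    b≥1 zero    = proj₁ (proj₂ (B∞ 1))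
    b≥1 (suc i) = ℕ.≤-trans (s≤s z≤n) (gap i)

  -- In the chosen sequence from B each term b is followed by one exceeding b + Θ(b); the pigeonhole
  -- principle applies to its first m + 1 terms modulo m. Θ depends on b₁ because P(b₁) may be a
  -- large negative number that b₂ has to outweigh.
  congruent-pair : ∀ m → 1 ≤ m →
    ∃₂ λ b₁ b₂ → 1 ≤ b₁ × B b₁ × B b₂ × suc b₁ + Θ b₁ ≤ b₂ × + m ∣ℤ + b₂ ℤ.- + b₁
  congruent-pair m@(suc _) _ with Fin.pigeonhole (ℕ.n<1+n m) (λ i → fromℕ< (ℕ.m%n<n (b (toℕ i)) m))
  ... | i , j , i<j , eq = b (toℕ i) , b (toℕ j) , b≥1 (toℕ i) , b∈B (toℕ i) , b∈B (toℕ j) , gaps i<j ,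
    %-≡⇒∣ m (b (toℕ j)) (b (toℕ i)) (sym (Fin.fromℕ<-injective _ _ (ℕ.m%n<n (b (toℕ i)) m) (ℕ.m%n<n (b (toℕ j)) m) eq))

sum-large : ∀ v b t s n → ℤ.∣ v ∣ + ℤ.∣ t ∣ + s ≤ b → v ℤ.+ + b ℤ.+ t ≡ + n → s ≤ n
sum-large v b t s n large eq = ℤ.drop‿+≤+ (begin
  + s
    ≡⟨ ℤ.+-identityˡ (+ s) ⟨
  0ℤ ℤ.+ + s
    ≤⟨ ℤ.+-monoˡ-≤ (+ s) (ℤ.+-mono-≤ (0≤i+∣i∣ v) (0≤i+∣i∣ t)) ⟩
  (v ℤ.+ + ℤ.∣ v ∣) ℤ.+ (t ℤ.+ + ℤ.∣ t ∣) ℤ.+ + s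
    ≡⟨ lemma v (+ ℤ.∣ v ∣) t (+ ℤ.∣ t ∣) (+ s) ⟩
  v ℤ.+ + (ℤ.∣ v ∣ + ℤ.∣ t ∣ + s) ℤ.+ t
    ≤⟨ ℤ.+-monoˡ-≤ t (ℤ.+-monoʳ-≤ v (+≤+ large)) ⟩
  v ℤ.+ + b ℤ.+ t
    ≡⟨ eq ⟩
  + n ∎)
  where
  open ℤ.≤-Reasoning
  lemma : ∀ v v′ t t′ s → (v ℤ.+ v′) ℤ.+ (t ℤ.+ t′) ℤ.+ s ≡ v ℤ.+ (v′ ℤ.+ t′ ℤ.+ s) ℤ.+ t
  lemma = solve-∀
  0≤i+∣i∣ : ∀ i → 0ℤ ℤ.≤ i ℤ.+ + ℤ.∣ i ∣
  0≤i+∣i∣ (+ n)    = +≤+ z≤n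
  0≤i+∣i∣ -[1+ n ] = ℤ.≤-reflexive (sym (ℤ.+-inverseʳ -[1+ n ]))

-- Infinite sets against the removed classes

module _ (g : ℕ → ℤ) (m : ℕ → ℕ) (R : ℕ → List ℤ) (1≤m : ∀ j → 1 ≤ m j)
         (R-covers : ∀ j → Covers (m j) (R j) (λ n → g n ℤ.+ (+ n ℤ.+ enum j))) where

  private
    A : ℕ → Bool
    A = complement (λ j → removed (m j) (R j))

  -- Since P(b₁) + b₂ + t - r = (f(b₁) - r) + (b₂ - b₁), the number n lies in a covering class. The
  -- bounds m j ≤ n and j < n ensure that this class is in fact removed at n.
  not-in-complement : ∀ j b₁ b₂ n → + m j ∣ℤ + b₂ ℤ.- + b₁ → g b₁ ℤ.+ + b₂ ℤ.+ enum j ≡ + n →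
    m j ≤ n → j ℕ.< n → A n ≢ true
  not-in-complement j b₁ b₂ n m∣ eq m≤n j<n An with R-covers j b₁
  ... | r , r∈R , m∣f = contradiction (trans (sym An) (cong not (anyBelow-true (λ j → removed (m j) (R j) n) j<n
          (cong₂ _∧_ (dec-true (m j ℕ.≤? n) m≤n) (inClasses-∈ {m j} {R j} {r} {n} r∈R m∣n))))) λ ()
    where
    lemma : ∀ v b₁ b₂ t r → (v ℤ.+ (b₁ ℤ.+ t) ℤ.- r) ℤ.+ (b₂ ℤ.- b₁) ≡ v ℤ.+ b₂ ℤ.+ t ℤ.- r
    lemma = solve-∀
    m∣n : + m j ∣ℤ + n ℤ.- r
    m∣n = subst (+ m j ∣ℤ_) (trans (lemma (g b₁) (+ b₁) (+ b₂) (enum j) r) (cong (ℤ._- r) eq)) (ℤ.∣m∣n⇒∣m+n m∣f m∣)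

  complement-avoids : ∀ P → (∀ n → values P n ≡ toℚ (g n)) → ∀ B t → PatternIn P B t A → ¬ Infinite B
  complement-avoids P P≗g B t inA B∞ with enum-surjective t
  -- Θ makes the resulting element at least m j + j + 1, past both thresholds from which the j-th
  -- classes are removed.
  ... | j , refl with congruent-pair B∞ (λ b → ℤ.∣ g b ∣ + ℤ.∣ enum j ∣ + (m j + suc j)) (m j) (1≤m j)
  ... | b₁ , b₂ , 1≤b₁ , b₁∈B , b₂∈B , far , m∣
      with inA b₁ b₂ 1≤b₁ b₁∈B b₂∈B (ℕ.≤-trans (ℕ.m≤m+n (suc b₁) _) far) (g b₁) (P≗g b₁)
  ... | n , eq , An = not-in-complement j b₁ b₂ (suc n) m∣ eq
          (ℕ.≤-trans (ℕ.m≤m+n (m j) (suc j)) large) (ℕ.≤-trans (ℕ.m≤n+m (suc j) (m j)) large) An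
    where
    large : m j + suc j ≤ suc n
    large = sum-large (g b₁) b₂ (enum j) (m j + suc j) (suc n) (ℕ.≤-trans (ℕ.m≤n+m _ (suc b₁)) far) eq

theorem1p5 : (P : Poly) → IntegerValued P → DegreeAtLeast2 P →
    (ε : ℚ) → 0ℚ < ε →
    ∃ λ (A : ℕ → Bool) → UpperBanachDensityGT A (1ℚ - ε) ×
    (∀ (B : ℕ → Set) (t : ℤ) → PatternIn P B t A → ¬ Infinite B)
theorem1p5 P integerValued degree ε 0<ε = A , (η , proj₂ close , 0 , dense) , complement-avoids g m R 1≤m R-covers P P≗g
  where
  g : ℕ → ℤ
  g n = proj₁ (integerValued (+ n))
  P≗g : ∀ n → values P n ≡ toℚ (g n)
  P≗g n = proj₂ (integerValued (+ n))
  k = proj₁ (degree≥2 P degree)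
  leading = hasDegree-integral (2 + k) {P} g P≗g (proj₂ (degree≥2 P degree))
  c = proj₁ leading
  close = 1-ε<[1+k]/[2+k] ε 0<ε
  K = 2 + proj₁ close
  η = + suc (proj₁ close) ℚ./ K
  -- The j-th removed set gets density at most 1/(K · 2^(j + 1)), so that all of them together take
  -- at most 1/K; the leading 2 is the one required by `count-removed`.
  cover : ∀ j → ∃₂ λ m R → 1 ≤ m × Covers m R (λ n → g n ℤ.+ (+ n ℤ.+ enum j)) × 2 * (K * 2 ^ suc j) * length R ≤ m
  cover j = sparse-cover k {c} {λ n → g n ℤ.+ (+ n ℤ.+ enum j)}
    (constDiff-+linear k {c} {g} (enum j) (proj₂ (proj₂ leading))) (proj₁ (proj₂ leading)) (2 * (K * 2 ^ suc j))
  m : ℕ → ℕ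
  m j = proj₁ (cover j)
  R : ℕ → List ℤ
  R j = proj₁ (proj₂ (cover j))
  1≤m : ∀ j → 1 ≤ m j
  1≤m j = proj₁ (proj₂ (proj₂ (cover j)))
  R-covers : ∀ j → Covers (m j) (R j) (λ n → g n ℤ.+ (+ n ℤ.+ enum j))
  R-covers j = proj₁ (proj₂ (proj₂ (proj₂ (cover j))))
  A : ℕ → Bool
  A = complement (λ j → removed (m j) (R j))
  dense : ∀ N → 1 ≤ N → 0 ≤ N → ∃ λ M → η ℚ.* toℚ (+ N) ℚ.≤ toℚ (+ count A M N)
  -- Initial segments serve as windows, with M = 0: the bound on `A` holds there for every N.
  dense N _ _ = 0 , fraction-bound (proj₁ close) N (count A 0 N)
    (count-complement-large K (λ j → removed (m j) (R j))
      (λ j → count-removed {K * 2 ^ suc j} {m j} {R j} (1≤m j) (proj₂ (proj₂ (proj₂ (proj₂ (cover j)))))) N)
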